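{- Let $k\ge 2$ be a fixed integer. For each positive integer $n$, place $n$ hyper-rooks at random on the $k$-dimensional chessboard with side length $n$, and let $S_{n,k}$ be the number of safe spaces. Then, as $n\to\infty$, $\mathbb{E}[S_{n,k}]$ is asymptotic to $n^k/e^k$; hence the probability that a space is safe converges to $1/e^k$.
   Context: The $k$-dimensional board of side length $n$ is the set of spaces $\{1,\dots,n\}^k$. "Placing $n$ pieces at random" means that the set of occupied spaces (the board configuration) is chosen uniformly among all $\binom{n^k}{n}$ subsets of $n$ distinct spaces. A hyper-rook attacks every space that shares at least one coordinate with it, i.e. a hyper-rook at $(a_1,\dots,a_k)$ attacks $(x_1,\dots,x_k)$ if $x_i=a_i$ for some $i$. A space is safe under a board configuration if it is neither occupied nor attacked by any of the placed pieces. (The probability that a given space is safe is the same for every space of the board.) -}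

module Defs where

open import Data.Empty using (⊥-elim)
open import Data.Fin.Base using (Fin; finToFun)
import Data.Fin.Properties as Fin
open import Data.Fin.Subset using (Subset; inside; outside; _∈_; _∉_) renaming (∣_∣ to card)
open import Data.Fin.Subset.Properties using (_∈?_)
open import Data.Integer.Base as ℤ using (+_; +[1+_]; -[1+_])
import Data.Integer.Properties as ℤ
open import Data.List.Base using (List; []; _∷_; _++_; map; filter; length; allFin)
open import Data.Nat.Base as ℕ using (ℕ; zero; suc; z≤n; s≤s; _!)
open import Data.Nat.ListAction using (sum)
import Data.Nat.Properties as ℕ
open import Data.Product.Base using (Σ; ∃; _×_; _,_; proj₁; proj₂)
open import Data.Rational.Base
open import Data.Rational.Properties
import Data.Rational.Unnormalised.Base as ℚᵘ
import Data.Rational.Unnormalised.Properties as ℚᵘ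
open import Data.Rational.Solver using (module +-*-Solver)
open import Data.Sum.Base using (inj₁; inj₂)
open import Data.Vec.Base as Vec using ([]; _∷_)
open import Relation.Binary.PropositionalEquality
open import Relation.Nullary using (¬_; Dec; yes; no; ¬?; _×-dec_; _→-dec_)
open import Relation.Unary using (Pred; Decidable)
open import Level using (0ℓ)

-- A quotient with zero denominator is set to 0; this value only occurs
-- for an empty sample space.
quot : ℕ → ℕ → ℚ
quot a zero    = 0ℚ
quot a (suc b) = + a / suc b

-- Expectation of X, and probability of P, under the uniform distribution
-- on the entries of a list Ω.
𝔼 : {A : Set} → List A → (A → ℕ) → ℚ
𝔼 Ω X = quot (sum (map X Ω)) (length Ω)

ℙ : {A : Set} {P : Pred A 0ℓ} → List A → Decidable P → ℚ
ℙ Ω P? = quot (length (filter P? Ω)) (length Ω)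

-- Every subset of Fin N exactly once.
allSubsets : (N : ℕ) → List (Subset N)
allSubsets zero    = [] ∷ []
allSubsets (suc N) =
  map (inside ∷_) (allSubsets N) ++ map (outside ∷_) (allSubsets N)

module Board (k n : ℕ) where

  -- The n ^ k points of {1,…,n}^k, numbered so that the library's subsets
  -- of Fin apply; finToFun is the bijection Fin (n ^ k) ≅ (Fin k → Fin n).
  Space : Set
  Space = Fin (n ℕ.^ k)

  coord : Space → Fin k → Fin n
  coord = finToFun

  Attacks : Space → Space → Set
  Attacks a x = ∃ λ i → coord x i ≡ coord a i

  -- A board configuration is the set of occupied spaces.
  Safe : Subset (n ℕ.^ k) → Space → Set
  Safe p x = x ∉ p × (∀ a → a ∈ p → ¬ Attacks a x)

  attacks? : ∀ a x → Dec (Attacks a x)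
  attacks? a x = Fin.any? λ i → coord x i Fin.≟ coord a i

  safe? : ∀ p x → Dec (Safe p x)
  safe? p x =
    ¬? (x ∈? p) ×-dec Fin.all? λ a → (a ∈? p) →-dec ¬? (attacks? a x)

  configurations : List (Subset (n ℕ.^ k))
  configurations = filter (λ p → card p ℕ.≟ n) (allSubsets (n ℕ.^ k))

  safeCount : Subset (n ℕ.^ k) → ℕ
  safeCount p = length (filter (safe? p) (allFin (n ℕ.^ k)))

  expectedSafe : ℚ
  expectedSafe = 𝔼 configurations safeCount

  probSafe : Space → ℚ
  probSafe x = ℙ configurations (λ p → safe? p x)

module ℚ-Lemmas where

  ∣p∣≤ε : ∀ {p ε} → p ≤ ε → - p ≤ ε → ∣ p ∣ ≤ ε
  ∣p∣≤ε {p} p≤ε -p≤ε with ∣p∣≡p∨∣p∣≡-p p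
  ... | inj₁ eq = subst (_≤ _) (sym eq) p≤ε
  ... | inj₂ eq = subst (_≤ _) (sym eq) -p≤ε

  ∣p-q∣≡∣q-p∣ : ∀ p q → ∣ p - q ∣ ≡ ∣ q - p ∣
  ∣p-q∣≡∣q-p∣ p q = trans (cong ∣_∣ (lem p q)) (∣-p∣≡∣p∣ (q - p))
    where
    open +-*-Solver
    lem : ∀ p q → p - q ≡ - (q - p)
    lem = solve 2 (λ p q → p :- q := :- (q :- p)) refl

  p≤r+q⇒p-q≤r : ∀ {p q r} → p ≤ r + q → p - q ≤ r
  p≤r+q⇒p-q≤r {p} {q} {r} h = subst (p - q ≤_) (lem r q) (+-monoˡ-≤ (- q) h)
    where
    open +-*-Solver
    lem : ∀ r q → r + q - q ≡ r
    lem = solve 2 (λ r q → r :+ q :- q := r) refl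

  ∣p∣-∣q∣≤∣p-q∣ : ∀ p q → ∣ p ∣ - ∣ q ∣ ≤ ∣ p - q ∣
  ∣p∣-∣q∣≤∣p-q∣ p q = p≤r+q⇒p-q≤r
    (subst (λ t → ∣ t ∣ ≤ ∣ p - q ∣ + ∣ q ∣) (lem p q) (∣p+q∣≤∣p∣+∣q∣ (p - q) q))
    where
    open +-*-Solver
    lem : ∀ p q → p - q + q ≡ p
    lem = solve 2 (λ p q → p :- q :+ q := p) refl

  ∣∣p∣-∣q∣∣≤∣p-q∣ : ∀ p q → ∣ ∣ p ∣ - ∣ q ∣ ∣ ≤ ∣ p - q ∣
  ∣∣p∣-∣q∣∣≤∣p-q∣ p q = ∣p∣≤ε (∣p∣-∣q∣≤∣p-q∣ p q)
    (subst₂ _≤_ (lem ∣ p ∣ ∣ q ∣) (∣p-q∣≡∣q-p∣ q p) (∣p∣-∣q∣≤∣p-q∣ q p))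
    where
    open +-*-Solver
    lem : ∀ p q → q - p ≡ - (p - q)
    lem = solve 2 (λ p q → q :- p := :- (p :- q)) refl

  -- The factors are explicit because _*_ on ℚ unfolds during unification,
  -- which makes inferring them slow.
  *-mono-≤ : ∀ p q r s → 0ℚ ≤ q → 0ℚ ≤ r → p ≤ q → r ≤ s → p * r ≤ q * s
  *-mono-≤ p q r s 0≤q 0≤r p≤q r≤s = ≤-trans
    (*-monoʳ-≤-nonNeg r {{nonNegative 0≤r}} p≤q)
    (*-monoˡ-≤-nonNeg q {{nonNegative 0≤q}} r≤s)

  0<p*q : ∀ p q → 0ℚ < p → 0ℚ < q → 0ℚ < p * q
  0<p*q p q 0<p 0<q =
    positive⁻¹ (p * q) {{pos*pos⇒pos p {{positive 0<p}} q {{positive 0<q}}}}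

  0<p+q : ∀ {p q} → 0ℚ ≤ p → 0ℚ < q → 0ℚ < p + q
  0<p+q = +-mono-≤-<

  0<1 : 0ℚ < 1ℚ
  0<1 = positive⁻¹ 1ℚ

  0<½ : 0ℚ < ½
  0<½ = positive⁻¹ ½

  ½p+½p≡p : ∀ p → ½ * p + ½ * p ≡ p
  ½p+½p≡p p = trans (sym (*-distribʳ-+ p ½ ½)) (*-identityˡ p)

  1/⁺ : ∀ {p} → 0ℚ < p → ℚ
  1/⁺ {p} 0<p = (1/ p) {{pos⇒nonZero p {{positive 0<p}}}}

  0<1/⁺ : ∀ {p} (0<p : 0ℚ < p) → 0ℚ < 1/⁺ 0<p
  0<1/⁺ {p} 0<p = positive⁻¹ (1/⁺ 0<p) {{1/pos⇒pos p {{positive 0<p}}}}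

  p*1/⁺p≡1 : ∀ {p} (0<p : 0ℚ < p) → p * 1/⁺ 0<p ≡ 1ℚ
  p*1/⁺p≡1 {p} 0<p = *-inverseʳ p {{pos⇒nonZero p {{positive 0<p}}}}

open ℚ-Lemmas

-- The reciprocal, with 1/0 = 0.
recip : ℚ → ℚ
recip p with p ≟ 0ℚ
... | yes _   = 0ℚ
... | no  p≢0 = (1/ p) {{≢-nonZero p≢0}}

module Recip-Lemmas where

  p*recip[p]≡1 : ∀ {p} → 0ℚ < p → p * recip p ≡ 1ℚ
  p*recip[p]≡1 {p} 0<p with p ≟ 0ℚ
  ... | yes p≡0 = ⊥-elim (<⇒≢ 0<p (sym p≡0))
  ... | no  p≢0 = *-inverseʳ p {{≢-nonZero p≢0}}

  0<recip : ∀ {p} → 0ℚ < p → 0ℚ < recip p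
  0<recip {p} 0<p with p ≟ 0ℚ
  ... | yes p≡0 = ⊥-elim (<⇒≢ 0<p (sym p≡0))
  ... | no  p≢0 = 0<1/⁺ 0<p

  recip-anti : ∀ {p q} → 0ℚ < p → p ≤ q → recip q ≤ recip p
  recip-anti {p} {q} 0<p p≤q = begin
    recip q                  ≡⟨ *-identityʳ (recip q) ⟨
    recip q * 1ℚ             ≡⟨ cong (recip q *_) (p*recip[p]≡1 0<p) ⟨
    recip q * (p * recip p)  ≤⟨ *-monoˡ-≤-nonNeg (recip q) {{nonNegative (<⇒≤ (0<recip 0<q))}}
                                 (*-monoʳ-≤-nonNeg (recip p) {{nonNegative (<⇒≤ (0<recip 0<p))}} p≤q) ⟩
    recip q * (q * recip p)  ≡⟨ *-assoc (recip q) q (recip p) ⟨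
    recip q * q * recip p    ≡⟨ cong (_* recip p) (trans (*-comm (recip q) q) (p*recip[p]≡1 0<q)) ⟩
    1ℚ * recip p             ≡⟨ *-identityˡ (recip p) ⟩
    recip p                  ∎
    where
    open ≤-Reasoning
    0<q = <-≤-trans 0<p p≤q

  recip-diff : ∀ {p q} → 0ℚ < p → 0ℚ < q →
               recip p - recip q ≡ recip p * recip q * (q - p)
  recip-diff {p} {q} 0<p 0<q = begin
    recip p - recip q
      ≡⟨ cong₂ _-_ (sym (*-identityʳ (recip p))) (sym (*-identityʳ (recip q))) ⟩
    recip p * 1ℚ - recip q * 1ℚ
      ≡⟨ cong₂ (λ s t → recip p * s - recip q * t)
               (sym (p*recip[p]≡1 0<q)) (sym (p*recip[p]≡1 0<p)) ⟩
    recip p * (q * recip q) - recip q * (p * recip p)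
      ≡⟨ lem p q (recip p) (recip q) ⟩
    recip p * recip q * (q - p) ∎
    where
    open ≡-Reasoning
    open +-*-Solver
    lem : ∀ p q r s → r * (q * s) - s * (p * r) ≡ r * s * (q - p)
    lem = solve 4 (λ p q r s → r :* (q :* s) :- s :* (p :* r) := r :* s :* (q :- p)) refl

open Recip-Lemmas

IsCauchy : (ℕ → ℚ) → Set
IsCauchy s = ∀ ε → 0ℚ < ε →
  ∃ λ N → ∀ m n → N ℕ.≤ m → N ℕ.≤ n → ∣ s m - s n ∣ ≤ ε

-- Equality of reals is not needed: limits only use _<ℝ_, which depends
-- on the sequences up to null sequences.
record ℝ : Set where
  constructor mkℝ
  field
    seq    : ℕ → ℚ
    cauchy : IsCauchy seq

open ℝ public

module Cauchy-Lemmas where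

  cauchy-scaled : ∀ s C → 0ℚ < C →
    (∀ ε → 0ℚ < ε → ∃ λ N → ∀ m n → N ℕ.≤ m → N ℕ.≤ n → ∣ s m - s n ∣ ≤ C * ε) →
    IsCauchy s
  cauchy-scaled s C 0<C h ε 0<ε with h (1/⁺ 0<C * ε) (0<p*q (1/⁺ 0<C) ε (0<1/⁺ 0<C) 0<ε)
  ... | N , hN = N , λ m n N≤m N≤n → ≤-trans (hN m n N≤m N≤n) (≤-reflexive C/C*ε≡ε)
    where
    C/C*ε≡ε : C * (1/⁺ 0<C * ε) ≡ ε
    C/C*ε≡ε = trans (sym (*-assoc C (1/⁺ 0<C) ε))
      (trans (cong (_* ε) (p*1/⁺p≡1 0<C)) (*-identityˡ ε))

  bounded : (x : ℝ) →
    ∃ λ B → 0ℚ < B × ∃ λ N → ∀ n → N ℕ.≤ n → ∣ seq x n ∣ ≤ B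
  bounded x with cauchy x 1ℚ 0<1
  ... | N , hN = ∣ seq x N ∣ + 1ℚ , 0<p+q (0≤∣p∣ (seq x N)) 0<1 , N , λ n N≤n → begin
    ∣ seq x n ∣                        ≡⟨ cong ∣_∣ (lem (seq x n) (seq x N)) ⟩
    ∣ seq x N + (seq x n - seq x N) ∣  ≤⟨ ∣p+q∣≤∣p∣+∣q∣ (seq x N) (seq x n - seq x N) ⟩
    ∣ seq x N ∣ + ∣ seq x n - seq x N ∣ ≤⟨ +-monoʳ-≤ ∣ seq x N ∣ (hN n N N≤n ℕ.≤-refl) ⟩
    ∣ seq x N ∣ + 1ℚ                   ∎
    where
    open ≤-Reasoning
    open +-*-Solver
    lem : ∀ p q → p ≡ q + (p - q)
    lem = solve 2 (λ p q → p := q :+ (p :- q)) refl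

open Cauchy-Lemmas

infixl 7 _*ℝ_ _÷ℝ_[_]
infixl 6 _-ℝ_
infixr 8 _^ℝ_
infix  4 _<ℝ_

fromℚ : ℚ → ℝ
fromℚ q = mkℝ (λ _ → q) λ ε 0<ε → 0 , λ _ _ _ _ →
  subst (λ t → ∣ t ∣ ≤ ε) (sym (+-inverseʳ q)) (<⇒≤ 0<ε)

fromℕ : ℕ → ℝ
fromℕ n = fromℚ (+ n / 1)

_-ℝ_ : ℝ → ℝ → ℝ
x -ℝ y = mkℝ (λ n → seq x n - seq y n) difference-cauchy
  where
  open +-*-Solver
  regroup : ∀ a b c d → (a - b) - (c - d) ≡ (a - c) - (b - d)
  regroup = solve 4 (λ a b c d → (a :- b) :- (c :- d) := (a :- c) :- (b :- d)) refl
  difference-cauchy : IsCauchy (λ n → seq x n - seq y n)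
  difference-cauchy ε 0<ε with cauchy x (½ * ε) (0<p*q ½ ε 0<½ 0<ε) | cauchy y (½ * ε) (0<p*q ½ ε 0<½ 0<ε)
  ... | M , hM | N , hN = M ℕ.⊔ N , λ m n ≤m ≤n →
    let xm = seq x m ; xn = seq x n ; ym = seq y m ; yn = seq y n in begin
    ∣ (xm - ym) - (xn - yn) ∣    ≡⟨ cong ∣_∣ (regroup xm ym xn yn) ⟩
    ∣ (xm - xn) - (ym - yn) ∣    ≤⟨ ∣p-q∣≤∣p∣+∣q∣ (xm - xn) (ym - yn) ⟩
    ∣ xm - xn ∣ + ∣ ym - yn ∣    ≤⟨ +-mono-≤
      (hM m n (ℕ.m⊔n≤o⇒m≤o M N ≤m) (ℕ.m⊔n≤o⇒m≤o M N ≤n))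
      (hN m n (ℕ.m⊔n≤o⇒n≤o M N ≤m) (ℕ.m⊔n≤o⇒n≤o M N ≤n)) ⟩
    ½ * ε + ½ * ε                ≡⟨ ½p+½p≡p ε ⟩
    ε                            ∎
    where open ≤-Reasoning

module Product-Lemmas where

  ∣ab-cd∣≤ : ∀ a b c d → ∣ a * b - c * d ∣ ≤ ∣ a ∣ * ∣ b - d ∣ + ∣ d ∣ * ∣ a - c ∣
  ∣ab-cd∣≤ a b c d = subst₂ _≤_ (cong ∣_∣ (sym (split a b c d)))
    (trans (cong (λ t → t + ∣ d * (a - c) ∣) (∣p*q∣≡∣p∣*∣q∣ a (b - d)))
           (cong (λ t → ∣ a ∣ * ∣ b - d ∣ + t) (∣p*q∣≡∣p∣*∣q∣ d (a - c))))
    (∣p+q∣≤∣p∣+∣q∣ (a * (b - d)) (d * (a - c)))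
    where
    open +-*-Solver
    split : ∀ a b c d → a * b - c * d ≡ a * (b - d) + d * (a - c)
    split = solve 4 (λ a b c d → a :* b :- c :* d := a :* (b :- d) :+ d :* (a :- c)) refl

  *-+-mono-≤ : ∀ p q r p′ q′ r′ → 0ℚ ≤ q → 0ℚ ≤ q′ → 0ℚ ≤ r → 0ℚ ≤ r′ → ∀ ε →
    p ≤ q → r ≤ ε → p′ ≤ q′ → r′ ≤ ε → p * r + p′ * r′ ≤ (q + q′) * ε
  *-+-mono-≤ p q r p′ q′ r′ 0≤q 0≤q′ 0≤r 0≤r′ ε p≤q r≤ε p′≤q′ r′≤ε =
    subst (p * r + p′ * r′ ≤_) (sym (*-distribʳ-+ ε q q′))
      (+-mono-≤ {p * r} {q * ε} {p′ * r′} {q′ * ε}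
        (*-mono-≤ p q r ε 0≤q 0≤r p≤q r≤ε) (*-mono-≤ p′ q′ r′ ε 0≤q′ 0≤r′ p′≤q′ r′≤ε))

open Product-Lemmas

_*ℝ_ : ℝ → ℝ → ℝ
x *ℝ y = mkℝ (λ n → seq x n * seq y n)
  (cauchy-scaled (λ n → seq x n * seq y n) (B + C) (0<p+q (<⇒≤ 0<B) 0<C) bound)
  where
  -- Projections rather than `with`: the latter would normalise the goal,
  -- which is prohibitively slow.
  bx = bounded x
  by = bounded y
  B = proj₁ bx ; 0<B = proj₁ (proj₂ bx) ; K = proj₁ (proj₂ (proj₂ bx)) ; hK = proj₂ (proj₂ (proj₂ bx))
  C = proj₁ by ; 0<C = proj₁ (proj₂ by) ; L = proj₁ (proj₂ (proj₂ by)) ; hL = proj₂ (proj₂ (proj₂ by))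
  bound : ∀ ε → 0ℚ < ε → ∃ λ N → ∀ m n → N ℕ.≤ m → N ℕ.≤ n →
    ∣ seq x m * seq y m - seq x n * seq y n ∣ ≤ (B + C) * ε
  bound ε 0<ε =
    let M , hM = cauchy x ε 0<ε
        N , hN = cauchy y ε 0<ε
    in (K ℕ.⊔ L) ℕ.⊔ (M ℕ.⊔ N) , λ m n ≤m ≤n →
    let K⊔L≤m = ℕ.m⊔n≤o⇒m≤o (K ℕ.⊔ L) (M ℕ.⊔ N) ≤m
        K⊔L≤n = ℕ.m⊔n≤o⇒m≤o (K ℕ.⊔ L) (M ℕ.⊔ N) ≤n
        M⊔N≤m = ℕ.m⊔n≤o⇒n≤o (K ℕ.⊔ L) (M ℕ.⊔ N) ≤m
        M⊔N≤n = ℕ.m⊔n≤o⇒n≤o (K ℕ.⊔ L) (M ℕ.⊔ N) ≤n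
        xm = seq x m ; xn = seq x n ; ym = seq y m ; yn = seq y n
    in ≤-trans (∣ab-cd∣≤ xm ym xn yn)
      (*-+-mono-≤ (∣ xm ∣) B (∣ ym - yn ∣) (∣ yn ∣) C (∣ xm - xn ∣)
        (<⇒≤ 0<B) (<⇒≤ 0<C) (0≤∣p∣ (ym - yn)) (0≤∣p∣ (xm - xn)) ε
        (hK m (ℕ.m⊔n≤o⇒m≤o K L K⊔L≤m))
        (hN m n (ℕ.m⊔n≤o⇒n≤o M N M⊔N≤m) (ℕ.m⊔n≤o⇒n≤o M N M⊔N≤n))
        (hL n (ℕ.m⊔n≤o⇒n≤o K L K⊔L≤n))
        (hM m n (ℕ.m⊔n≤o⇒m≤o M N M⊔N≤m) (ℕ.m⊔n≤o⇒m≤o M N M⊔N≤n)))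

_^ℝ_ : ℝ → ℕ → ℝ
x ^ℝ zero  = fromℕ 1
x ^ℝ suc k = x *ℝ x ^ℝ k

∣_∣ℝ : ℝ → ℝ
∣ x ∣ℝ = mkℝ (λ n → ∣ seq x n ∣) λ ε 0<ε → let N , hN = cauchy x ε 0<ε in
  N , λ m n N≤m N≤n → ≤-trans (∣∣p∣-∣q∣∣≤∣p-q∣ (seq x m) (seq x n)) (hN m n N≤m N≤n)

-- Positivity is a bound away from 0, as usual constructively.
Positiveℝ : ℝ → Set
Positiveℝ x = ∃ λ δ → 0ℚ < δ × ∃ λ N → ∀ n → N ℕ.≤ n → δ ≤ seq x n

_<ℝ_ : ℝ → ℝ → Set
x <ℝ y = Positiveℝ (y -ℝ x)

-- Finitely many terms of the sequence may vanish, whence recip.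
reciprocal : (x : ℝ) → Positiveℝ x → ℝ
reciprocal x (δ , 0<δ , K , hK) =
  mkℝ (λ n → recip (seq x n)) (cauchy-scaled (λ n → recip (seq x n)) (D * D) (0<p*q D D 0<D 0<D) bound)
  where
  D = recip δ
  0<D = 0<recip 0<δ
  bound : ∀ ε → 0ℚ < ε → ∃ λ N → ∀ m n → N ℕ.≤ m → N ℕ.≤ n →
    ∣ recip (seq x m) - recip (seq x n) ∣ ≤ D * D * ε
  bound ε 0<ε = let N , hN = cauchy x ε 0<ε in K ℕ.⊔ N , λ m n ≤m ≤n →
    let a = seq x m ; b = seq x n
        δ≤a = hK m (ℕ.m⊔n≤o⇒m≤o K N ≤m) ; 0<a = <-≤-trans 0<δ δ≤a
        δ≤b = hK n (ℕ.m⊔n≤o⇒m≤o K N ≤n) ; 0<b = <-≤-trans 0<δ δ≤b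
    in begin
    ∣ recip a - recip b ∣
      ≡⟨ cong ∣_∣ (recip-diff 0<a 0<b) ⟩
    ∣ recip a * recip b * (b - a) ∣
      ≡⟨ ∣p*q∣≡∣p∣*∣q∣ (recip a * recip b) (b - a) ⟩
    ∣ recip a * recip b ∣ * ∣ b - a ∣
      ≡⟨ cong (_* ∣ b - a ∣) (0≤p⇒∣p∣≡p (<⇒≤ (0<p*q (recip a) (recip b) (0<recip 0<a) (0<recip 0<b)))) ⟩
    recip a * recip b * ∣ b - a ∣
      ≤⟨ *-mono-≤ (recip a * recip b) (D * D) (∣ b - a ∣) ε (<⇒≤ (0<p*q D D 0<D 0<D)) (0≤∣p∣ (b - a))
           (*-mono-≤ (recip a) D (recip b) D (<⇒≤ 0<D) (<⇒≤ (0<recip 0<b)) (recip-anti 0<δ δ≤a) (recip-anti 0<δ δ≤b))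
           (hN n m (ℕ.m⊔n≤o⇒n≤o K N ≤n) (ℕ.m⊔n≤o⇒n≤o K N ≤m)) ⟩
    D * D * ε ∎
    where open ≤-Reasoning

_÷ℝ_[_] : (x y : ℝ) → Positiveℝ y → ℝ
x ÷ℝ y [ y>0 ] = x *ℝ reciprocal y y>0

*-positive : ∀ x y → Positiveℝ x → Positiveℝ y → Positiveℝ (x *ℝ y)
*-positive x y (δ , 0<δ , M , hM) (η , 0<η , N , hN) =
  δ * η , 0<p*q δ η 0<δ 0<η , M ℕ.⊔ N , λ n ≤n →
    let δ≤x = hM n (ℕ.m⊔n≤o⇒m≤o M N ≤n) in
    *-mono-≤ δ (seq x n) η (seq y n) (<⇒≤ (<-≤-trans 0<δ δ≤x)) (<⇒≤ 0<η) δ≤x (hN n (ℕ.m⊔n≤o⇒n≤o M N ≤n))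

^-positive : ∀ x → Positiveℝ x → ∀ k → Positiveℝ (x ^ℝ k)
^-positive x x>0 zero    = 1ℚ , 0<1 , 0 , λ _ _ → ≤-refl
^-positive x x>0 (suc k) = *-positive x (x ^ℝ k) x>0 (^-positive x x>0 k)

infix 4 _⟶_ _∼_

-- Quantifying over rational ε loses nothing: every positive real exceeds
-- a positive rational.
_⟶_ : (ℕ → ℝ) → ℝ → Set
a ⟶ L = ∀ ε → 0ℚ < ε →
  ∃ λ N → ∀ n → N ℕ.≤ n → ∣ a n -ℝ L ∣ℝ <ℝ fromℚ ε

-- Asymptotic equivalence to a positive sequence: a n / b n tends to 1.
_∼_ : (ℕ → ℝ) → (ℕ → ℝ) → Set
a ∼ b = Σ (∀ n → Positiveℝ (b n)) λ b>0 →
  (λ n → a n ÷ℝ b n [ b>0 n ]) ⟶ fromℕ 1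

invFactorial : ℕ → ℚ
invFactorial n = (+ 1 / n !) {{n ℕ.!≢0}}

-- 1/0! + ⋯ + 1/n!
expSum : ℕ → ℚ
expSum zero    = invFactorial 0
expSum (suc n) = expSum n + invFactorial (suc n)

module ExpSum-Lemmas where

  1/[a*b]≡1/a*1/b : ∀ a b .{{_ : ℕ.NonZero a}} .{{_ : ℕ.NonZero b}} .{{_ : ℕ.NonZero (a ℕ.* b)}} →
    + 1 / (a ℕ.* b) ≡ (+ 1 / a) * (+ 1 / b)
  1/[a*b]≡1/a*1/b (suc a) (suc b) = toℚᵘ-injective (begin
    toℚᵘ (+ 1 / (suc a ℕ.* suc b))           ≈⟨ toℚᵘ-fromℚᵘ (ℚᵘ.mkℚᵘ (+ 1) (b ℕ.+ a ℕ.* suc b)) ⟩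
    ℚᵘ.mkℚᵘ (+ 1) a ℚᵘ.* ℚᵘ.mkℚᵘ (+ 1) b     ≈⟨ ℚᵘ.*-cong (toℚᵘ-fromℚᵘ (ℚᵘ.mkℚᵘ (+ 1) a))
                                                           (toℚᵘ-fromℚᵘ (ℚᵘ.mkℚᵘ (+ 1) b)) ⟨
    toℚᵘ (+ 1 / suc a) ℚᵘ.* toℚᵘ (+ 1 / suc b) ≈⟨ toℚᵘ-homo-* (+ 1 / suc a) (+ 1 / suc b) ⟨
    toℚᵘ ((+ 1 / suc a) * (+ 1 / suc b))     ∎)
    where open ℚᵘ.≃-Reasoning

  1/suc-anti : ∀ {a b} → a ℕ.≤ b → + 1 / suc b ≤ + 1 / suc a
  1/suc-anti {a} {b} a≤b = toℚᵘ-cancel-≤ (begin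
    toℚᵘ (+ 1 / suc b)  ≃⟨ toℚᵘ-fromℚᵘ (ℚᵘ.mkℚᵘ (+ 1) b) ⟩
    ℚᵘ.mkℚᵘ (+ 1) b     ≤⟨ ℚᵘ.*≤* (ℤ.*-monoˡ-≤-nonNeg (+ 1) (ℤ.+≤+ (s≤s a≤b))) ⟩
    ℚᵘ.mkℚᵘ (+ 1) a     ≃⟨ toℚᵘ-fromℚᵘ (ℚᵘ.mkℚᵘ (+ 1) a) ⟨
    toℚᵘ (+ 1 / suc a)  ∎)
    where open ℚᵘ.≤-Reasoning

  archimedean : ∀ ε → 0ℚ < ε → ∃ λ N → + 1 / suc N ≤ ε
  archimedean (mkℚ (+ 0)    d c) (*<* (ℤ.+<+ ()))
  archimedean (mkℚ -[1+ _ ] d c) (*<* ())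
  archimedean ε@(mkℚ +[1+ a ] d c) _ = d , toℚᵘ-cancel-≤ (begin
    toℚᵘ (+ 1 / suc d)    ≃⟨ toℚᵘ-fromℚᵘ (ℚᵘ.mkℚᵘ (+ 1) d) ⟩
    ℚᵘ.mkℚᵘ (+ 1) d       ≤⟨ ℚᵘ.*≤* (ℤ.*-monoʳ-≤-nonNeg (+ suc d) (ℤ.+≤+ {1} {suc a} (s≤s z≤n))) ⟩
    ℚᵘ.mkℚᵘ +[1+ a ] d    ∎)
    where open ℚᵘ.≤-Reasoning

  0≤invFactorial : ∀ n → 0ℚ ≤ invFactorial n
  0≤invFactorial n = nonNegative⁻¹ (invFactorial n) {{normalize-nonNeg 1 (n !) {{n ℕ.!≢0}}}}

  invFactorial-suc : ∀ n → invFactorial (suc n) ≡ (+ 1 / suc n) * invFactorial n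
  invFactorial-suc n = 1/[a*b]≡1/a*1/b (suc n) (n !) {{_}} {{n ℕ.!≢0}} {{suc n ℕ.!≢0}}

  invFactorial-halves : ∀ n → invFactorial (2 ℕ.+ n) ≤ ½ * invFactorial (suc n)
  invFactorial-halves n = ≤-trans (≤-reflexive (invFactorial-suc (suc n)))
    (*-monoʳ-≤-nonNeg (invFactorial (suc n)) {{nonNegative (0≤invFactorial (suc n))}}
      (1/suc-anti {1} {suc n} (s≤s z≤n)))

  invFactorial≤1/ : ∀ n → invFactorial (suc n) ≤ + 1 / suc n
  invFactorial≤1/ n = ≤-trans (≤-reflexive (invFactorial-suc n))
    (≤-trans (*-monoˡ-≤-nonNeg (+ 1 / suc n) {{normalize-nonNeg 1 (suc n)}} (f≤1 n))
             (≤-reflexive (*-identityʳ (+ 1 / suc n))))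
    where
    f≤1 : ∀ n → invFactorial n ≤ 1ℚ
    f≤1 zero    = ≤-refl
    f≤1 (suc n) = ≤-trans (≤-reflexive (invFactorial-suc n))
      (≤-trans (*-mono-≤ (+ 1 / suc n) 1ℚ (invFactorial n) 1ℚ (<⇒≤ 0<1) (0≤invFactorial n)
                 (1/suc-anti {0} {n} z≤n) (f≤1 n))
               (≤-reflexive (*-identityʳ 1ℚ)))

  expSum-mono : ∀ n j → expSum n ≤ expSum (j ℕ.+ n)
  expSum-mono n zero    = ≤-refl
  expSum-mono n (suc j) = ≤-trans (expSum-mono n j)
    (subst (_≤ expSum (suc j ℕ.+ n)) (+-identityʳ (expSum (j ℕ.+ n)))
      (+-monoʳ-≤ (expSum (j ℕ.+ n)) (0≤invFactorial (suc j ℕ.+ n))))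

  -- expSum n + 1/n! is decreasing for n ≥ 1 and bounds e from above.
  expSum-upper : ∀ n j → expSum (j ℕ.+ suc n) + invFactorial (j ℕ.+ suc n)
                       ≤ expSum (suc n) + invFactorial (suc n)
  expSum-upper n zero    = ≤-refl
  expSum-upper n (suc j) = ≤-trans (step (j ℕ.+ suc n) (ℕ.m≤n+m (suc n) j)) (expSum-upper n j)
    where
    step : ∀ m → suc n ℕ.≤ m →
      expSum (suc m) + invFactorial (suc m) ≤ expSum m + invFactorial m
    step (suc m) _ = begin
      expSum (suc m) + f₂ + f₂    ≡⟨ +-assoc (expSum (suc m)) f₂ f₂ ⟩
      expSum (suc m) + (f₂ + f₂)  ≤⟨ +-monoʳ-≤ (expSum (suc m)) (+-mono-≤ {f₂} {½ * f₁} {f₂} {½ * f₁}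
                                       (invFactorial-halves m) (invFactorial-halves m)) ⟩
      expSum (suc m) + (½ * f₁ + ½ * f₁) ≡⟨ cong (λ t → expSum (suc m) + t) (½p+½p≡p f₁) ⟩
      expSum (suc m) + f₁         ∎
      where
      open ≤-Reasoning
      f₁ = invFactorial (suc m)
      f₂ = invFactorial (2 ℕ.+ m)

  expSum-bounds : ∀ N n → suc N ℕ.≤ n →
    expSum (suc N) ≤ expSum n × expSum n ≤ expSum (suc N) + + 1 / suc N
  expSum-bounds N n N<n = subst
    (λ m → expSum (suc N) ≤ expSum m × expSum m ≤ expSum (suc N) + + 1 / suc N)
    (ℕ.m∸n+n≡m N<n)
    ( expSum-mono (suc N) j
    , ≤-trans (subst (_≤ expSum m + invFactorial m) (+-identityʳ (expSum m))
                (+-monoʳ-≤ (expSum m) (0≤invFactorial m)))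
        (≤-trans (expSum-upper N j) (+-monoʳ-≤ (expSum (suc N)) (invFactorial≤1/ N))))
    where
    j = n ℕ.∸ suc N
    m = j ℕ.+ suc N

  between : ∀ {a b c δ} → a ≤ b → b ≤ a + δ → a ≤ c → c ≤ a + δ → ∣ b - c ∣ ≤ δ
  between {a} {b} {c} {δ} a≤b b≤a+δ a≤c c≤a+δ = ∣p∣≤ε
    (p≤r+q⇒p-q≤r (≤-trans b≤a+δ (subst (_≤ δ + c) (+-comm δ a) (+-monoʳ-≤ δ a≤c))))
    (subst (_≤ δ) (lem b c) (p≤r+q⇒p-q≤r (≤-trans c≤a+δ (subst (_≤ δ + b) (+-comm δ a) (+-monoʳ-≤ δ a≤b)))))
    where
    open +-*-Solver
    lem : ∀ b c → c - b ≡ - (b - c)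
    lem = solve 2 (λ b c → c :- b := :- (b :- c)) refl

open ExpSum-Lemmas

e : ℝ
e = mkℝ expSum λ ε 0<ε →
  let N , 1/N≤ε = archimedean ε 0<ε in suc N , λ m n N<m N<n →
  let m-bounds = expSum-bounds N m N<m
      n-bounds = expSum-bounds N n N<n
  in ≤-trans
    (between {expSum (suc N)} {expSum m} {expSum n}
      (proj₁ m-bounds) (proj₂ m-bounds) (proj₁ n-bounds) (proj₂ n-bounds))
    1/N≤ε

e-positive : Positiveℝ e
e-positive = 1ℚ , 0<1 , 0 , λ n _ →
  subst (λ m → 1ℚ ≤ expSum m) (ℕ.+-identityʳ n) (expSum-mono 0 n)

e^-positive : ∀ k → Positiveℝ (e ^ℝ k)
e^-positive = ^-positive e e-positive

{-# OPTIONS --safe #-}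
module Submission where

-- A space x is safe when all n pieces avoid the coordinates of x, so it is safe
-- with probability p = C((n-1)^k, n) / C(n^k, n); double counting gives n^k p
-- safe spaces on average.  Since k ≥ 2, drawing without replacement costs
-- little: 0 ≤ r^(kn) - p ≤ k/n for r = 1 - 1/n.
--
-- It remains to compare r^n with 1/e.  Let F(t) = Σ_{i≤J} t^i/i! and
-- G(t) = F(t) + t^J/J!.  For h = 1/n, termwise estimates give
-- (1-h) F(t+h) ≤ F(t) and, on [0,1], G(t+h) ≥ (1+h) G(t).  Taking n steps from
-- 0 to 1 yields r^n F(1) ≤ 1 and G(1) ≥ (1+h)^n, and r^n (1+h)^n = (1-h²)^n ≥ 1-h
-- by Bernoulli.  Hence 1 - 2/n ≤ r^n F(1) ≤ 1 once J > n, and p F(1)^k is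
-- within a constant multiple of 1/n of 1.

open import Defs

-- Reals are Cauchy sequences of rationals and `e` is the sequence of its partial sums, so each
-- claim concerns rationals indexed by the side n and a truncation J. Positivity of a real looks
-- only at a tail of its sequence, hence J may be taken large depending on n, and J > n already
-- makes 1/J! at most 1/n. Everything becomes a finite rational inequality with an explicit
-- constant; the limit is taken once, at the end. Two polynomials are needed because a truncated
-- series satisfies y' = y only up to its last term: F' ≤ F, which helps in one direction only,
-- while G is built so that G' ≥ G on [0,1]. The two step estimates are a backward and a forward
-- Euler step for y' = y, and r = 1 - h is precisely the backward multiplier. For the cost of
-- drawing without replacement, put N = n^k and ρ = r^k. The i-th of the n factors falls short of ρ
-- by i(1-ρ)/(N-i). Since 1-ρ ≤ k/n, and N ≥ n² gives N-i ≥ in, each shortfall is at most k/n². The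
-- side is written `suc m` throughout.

module Counting where

  open import Data.Bool.Base using (true; false)
  open import Data.Empty using (⊥-elim)
  open import Data.Fin.Base using (Fin; zero; suc; combine; finToFun; _↑ˡ_; _↑ʳ_)
  import Data.Fin.Properties as Fin
  open import Data.Fin.Subset using (Subset; inside; outside; _∈_) renaming (∣_∣ to card)
  open import Data.Fin.Subset.Properties using (_∈?_)
  open import Data.List.Base using (List; []; _∷_; _++_; map; filter; length; allFin; tabulate)
  open import Data.List.Properties
    using (filter-++; filter-≐; filter-all; filter-accept; filter-reject;
           map-++; map-∘; map-tabulate; length-++; length-tabulate)
  import Data.List.Relation.Unary.All as All
  open import Data.Nat.Base
  open import Data.Nat.Combinatorics using (_C_; nCk+nC[k+1]≡[n+1]C[k+1])
  open import Data.Nat.ListAction using (sum)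
  open import Data.Nat.Properties
  open import Data.Nat.Solver using (module +-*-Solver)
  open import Data.Product.Base using (∃; _×_; _,_; proj₁; proj₂)
  open import Data.Unit.Base using (tt)
  open import Data.Vec.Base using ([]; _∷_; here; there)
  open import Function.Base using (_∘_)
  open import Level using (0ℓ)
  open import Relation.Binary.PropositionalEquality
    using (_≡_; _≢_; refl; sym; trans; cong; cong₂; module ≡-Reasoning)
  open import Relation.Nullary using (¬_; Dec; yes; no; ¬?; does; _×-dec_; _→-dec_)
  open import Relation.Unary using (Pred; Decidable; _≐_)

  private variable
    A B : Set

  -- Counting list entries that satisfy a decidable predicate

  count : {P : Pred A 0ℓ} → Decidable P → List A → ℕ
  count P? xs = length (filter P? xs)

  module _ {P : Pred A 0ℓ} (P? : Decidable P) where

    count-≐ : ∀ {Q : Pred A 0ℓ} (Q? : Decidable Q) → P ≐ Q → ∀ xs → count P? xs ≡ count Q? xs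
    count-≐ Q? P≐Q xs = cong length (filter-≐ P? Q? P≐Q xs)

    count-++ : ∀ xs ys → count P? (xs ++ ys) ≡ count P? xs + count P? ys
    count-++ xs ys = trans (cong length (filter-++ P? xs ys)) (length-++ (filter P? xs))

    count-map : (f : B → A) → ∀ xs → count P? (map f xs) ≡ count (P? ∘ f) xs
    count-map f []       = refl
    count-map f (x ∷ xs) with does (P? (f x))
    ... | true  = cong suc (count-map f xs)
    ... | false = count-map f xs

    count-filter : ∀ {Q : Pred A 0ℓ} (Q? : Decidable Q) xs →
      count P? (filter Q? xs) ≡ count (λ x → Q? x ×-dec P? x) xs
    count-filter Q? []       = refl
    count-filter Q? (x ∷ xs) with does (Q? x)
    ... | false = count-filter Q? xs
    ... | true with does (P? x)
    ...   | true  = cong suc (count-filter Q? xs)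
    ...   | false = count-filter Q? xs

    count-none : (∀ x → ¬ P x) → ∀ xs → count P? xs ≡ 0
    count-none ¬P []       = refl
    count-none ¬P (x ∷ xs) with P? x
    ... | yes Px = ⊥-elim (¬P x Px)
    ... | no  _  = count-none ¬P xs

    count-tabulate : ∀ {n} (f : Fin n → A) → count P? (tabulate f) ≡ count (P? ∘ f) (allFin n)
    count-tabulate f = trans (cong (count P?) (sym (map-tabulate (λ i → i) f))) (count-map f (allFin _))

  -- Double counting of related pairs. It turns the total number of safe spaces over all
  -- configurations into a sum over spaces of the number of configurations that keep the space safe.
  sum-count-swap : {R : A → Pred B 0ℓ} (R? : ∀ x → Decidable (R x)) → ∀ xs ys →
    sum (map (λ x → count (R? x) ys) xs) ≡ sum (map (λ y → count (λ x → R? x y) xs) ys)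
  sum-count-swap R? []       []       = refl
  sum-count-swap R? []       (y ∷ ys) = sum-count-swap R? [] ys
  sum-count-swap R? (x ∷ xs) ys = trans
    (cong (count (R? x) ys +_) (sum-count-swap R? xs ys)) (split ys)
    where
    open +-*-Solver
    split : ∀ ys → count (R? x) ys + sum (map (λ y → count (λ x → R? x y) xs) ys)
                 ≡ sum (map (λ y → count (λ x → R? x y) (x ∷ xs)) ys)
    split []       = refl
    split (y ∷ ys) with does (R? x y)
    ... | true  = cong suc (trans
      (solve 3 (λ a b c → a :+ (b :+ c) := b :+ (a :+ c)) refl
        (count (R? x) ys) (count (λ x → R? x y) xs) (sum (map (λ y → count (λ x → R? x y) xs) ys)))
      (cong (count (λ x → R? x y) xs +_) (split ys)))
    ... | false = trans
      (solve 3 (λ a b c → a :+ (b :+ c) := b :+ (a :+ c)) refl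
        (count (R? x) ys) (count (λ x → R? x y) xs) (sum (map (λ y → count (λ x → R? x y) xs) ys)))
      (cong (count (λ x → R? x y) xs +_) (split ys))

  sum-map-const : ∀ (f : A → ℕ) c → (∀ x → f x ≡ c) → ∀ xs → sum (map f xs) ≡ length xs * c
  sum-map-const f c f≡c []       = refl
  sum-map-const f c f≡c (x ∷ xs) = cong₂ _+_ (f≡c x) (sum-map-const f c f≡c xs)

  -- Subsets of prescribed size inside a given set

  _⊆ₚ_ : ∀ {N} → Subset N → Pred (Fin N) 0ℓ → Set
  p ⊆ₚ Q = ∀ a → a ∈ p → Q a

  ⊆? : ∀ {N} {Q : Pred (Fin N) 0ℓ} (Q? : Decidable Q) (p : Subset N) → Dec (p ⊆ₚ Q)
  ⊆? Q? p = Fin.all? λ a → (a ∈? p) →-dec Q? a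

  module _ {N} {Q : Pred (Fin (suc N)) 0ℓ} {p : Subset N} where

    ⊆-tail : ∀ {s} → (s ∷ p) ⊆ₚ Q → p ⊆ₚ (Q ∘ suc)
    ⊆-tail h a a∈p = h (suc a) (there a∈p)

    inside-⊆ : Q zero → p ⊆ₚ (Q ∘ suc) → (inside ∷ p) ⊆ₚ Q
    inside-⊆ q h zero    _           = q
    inside-⊆ q h (suc a) (there a∈p) = h a a∈p

    outside-⊆ : p ⊆ₚ (Q ∘ suc) → (outside ∷ p) ⊆ₚ Q
    outside-⊆ h (suc a) (there a∈p) = h a a∈p

  -- Pascal's rule, according to whether the subset contains `zero`: if `Q zero` holds, the two
  -- cases are its two summands; otherwise the first case is empty. Keeping `Q` arbitrary lets one
  -- lemma count both the favourable configurations and all of them.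
  subsets-within : ∀ N {Q : Pred (Fin N) 0ℓ} (Q? : Decidable Q) c →
    count (λ p → (card p ≟ c) ×-dec ⊆? Q? p) (allSubsets N) ≡ count Q? (allFin N) C c
  subsets-within zero    Q? zero    = refl
  subsets-within zero    Q? (suc c) = refl
  subsets-within (suc N) {Q} Q? c = begin
    count W? (map (inside ∷_) Ω ++ map (outside ∷_) Ω)
      ≡⟨ count-++ W? (map (inside ∷_) Ω) (map (outside ∷_) Ω) ⟩
    count W? (map (inside ∷_) Ω) + count W? (map (outside ∷_) Ω)
      ≡⟨ cong₂ _+_ (count-map W? (inside ∷_) Ω) (count-map W? (outside ∷_) Ω) ⟩
    count (W? ∘ (inside ∷_)) Ω + count (W? ∘ (outside ∷_)) Ω
      ≡⟨ cong (count (W? ∘ (inside ∷_)) Ω +_) outside-count ⟩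
    count (W? ∘ (inside ∷_)) Ω + count Q′? (allFin N) C c
      ≡⟨ pascal c (Q? zero) ⟩
    (count Q? (zero ∷ []) + count Q′? (allFin N)) C c
      ≡⟨ cong (λ t → (count Q? (zero ∷ []) + t) C c) (count-tabulate Q? suc) ⟨
    (count Q? (zero ∷ []) + count Q? (tabulate suc)) C c
      ≡⟨ cong (_C c) (count-++ Q? (zero ∷ []) (tabulate suc)) ⟨
    count Q? (allFin (suc N)) C c ∎
    where
    open ≡-Reasoning
    Ω = allSubsets N
    Q′? = Q? ∘ suc
    W? : Decidable (λ p → card p ≡ c × p ⊆ₚ Q)
    W? p = (card p ≟ c) ×-dec ⊆? Q? p
    outside-count : count (W? ∘ (outside ∷_)) Ω ≡ count Q′? (allFin N) C c
    outside-count = trans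
      (count-≐ (W? ∘ (outside ∷_)) (λ p → (card p ≟ c) ×-dec ⊆? Q′? p)
        ((λ (e , h) → e , ⊆-tail h) , (λ (e , h) → e , outside-⊆ h)) Ω)
      (subsets-within N Q′? c)
    pascal : ∀ c → Dec (Q zero) →
      count (λ p → (card (inside ∷ p) ≟ c) ×-dec ⊆? Q? (inside ∷ p)) Ω + count Q′? (allFin N) C c
      ≡ (count Q? (zero ∷ []) + count Q′? (allFin N)) C c
    pascal c (no ¬q) = cong₂ _+_
      (count-none (λ p → (card (inside ∷ p) ≟ c) ×-dec ⊆? Q? (inside ∷ p)) (λ p (_ , h) → ¬q (h zero here)) Ω)
      (cong (λ t → (t + count Q′? (allFin N)) C c) (sym (cong length (filter-reject Q? ¬q))))
    -- A subset containing `zero` is not empty, so only the summand from subsets without `zero`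
    -- remains, and that is 1.
    pascal zero (yes q) = cong (_+ 1)
      (count-none (λ p → (card (inside ∷ p) ≟ 0) ×-dec ⊆? Q? (inside ∷ p)) (λ p ()) Ω)
    pascal (suc c) (yes q) = begin
      count (λ p → (card (inside ∷ p) ≟ suc c) ×-dec ⊆? Q? (inside ∷ p)) Ω + K C suc c
        ≡⟨ cong (_+ K C suc c) (count-≐ _ (λ p → (card p ≟ c) ×-dec ⊆? Q′? p)
             ((λ (e , h) → suc-injective e , ⊆-tail h) , (λ (e , h) → cong suc e , inside-⊆ q h)) Ω) ⟩
      count (λ p → (card p ≟ c) ×-dec ⊆? Q′? p) Ω + K C suc c
        ≡⟨ cong (_+ K C suc c) (subsets-within N Q′? c) ⟩
      K C c + K C suc c
        ≡⟨ nCk+nC[k+1]≡[n+1]C[k+1] K c ⟩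
      suc K C suc c
        ≡⟨ cong (λ t → (t + K) C suc c) (cong length (filter-accept Q? q)) ⟨
      (count Q? (zero ∷ []) + K) C suc c ∎
      where K = count Q′? (allFin N)

  -- Spaces sharing no coordinate with a given one

  count-combine : ∀ m n {P : Pred (Fin (m * n)) 0ℓ} (P? : Decidable P) →
    count P? (allFin (m * n)) ≡ sum (map (λ i → count (λ j → P? (combine i j)) (allFin n)) (allFin m))
  count-combine zero    n P? = refl
  count-combine (suc m) n P? = begin
    count P? (allFin (n + m * n))
      ≡⟨ cong (count P?) (allFin-+ n (m * n)) ⟩
    count P? (map (_↑ˡ m * n) (allFin n) ++ map (n ↑ʳ_) (allFin (m * n)))
      ≡⟨ count-++ P? (map (_↑ˡ m * n) (allFin n)) (map (n ↑ʳ_) (allFin (m * n))) ⟩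
    count P? (map (_↑ˡ m * n) (allFin n)) + count P? (map (n ↑ʳ_) (allFin (m * n)))
      ≡⟨ cong₂ _+_ (count-map P? (_↑ˡ m * n) (allFin n)) (count-map P? (n ↑ʳ_) (allFin (m * n))) ⟩
    row zero + count (λ j → P? (n ↑ʳ j)) (allFin (m * n))
      ≡⟨ cong (row zero +_) (count-combine m n (λ j → P? (n ↑ʳ j))) ⟩
    row zero + sum (map (λ i → row (suc i)) (allFin m))
      ≡⟨ cong (λ l → row zero + sum l) (trans (map-tabulate (λ i → i) (row ∘ suc)) (sym (map-tabulate suc row))) ⟩
    sum (map row (allFin (suc m))) ∎
    where
    open ≡-Reasoning
    row : Fin (suc m) → ℕ
    row i = count (λ j → P? (combine i j)) (allFin n)
    allFin-+ : ∀ a b → allFin (a + b) ≡ map (_↑ˡ b) (allFin a) ++ map (a ↑ʳ_) (allFin b)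
    allFin-+ zero    b = sym (map-tabulate (λ i → i) (λ i → i))
    allFin-+ (suc a) b = cong (zero ∷_) (begin
      tabulate suc
        ≡⟨ map-tabulate (λ i → i) suc ⟨
      map suc (allFin (a + b))
        ≡⟨ cong (map suc) (allFin-+ a b) ⟩
      map suc (map (_↑ˡ b) (allFin a) ++ map (a ↑ʳ_) (allFin b))
        ≡⟨ map-++ suc (map (_↑ˡ b) (allFin a)) (map (a ↑ʳ_) (allFin b)) ⟩
      map suc (map (_↑ˡ b) (allFin a)) ++ map suc (map (a ↑ʳ_) (allFin b))
        ≡⟨ cong₂ _++_ (map-∘ (allFin a)) (map-∘ (allFin b)) ⟨
      map (suc ∘ (_↑ˡ b)) (allFin a) ++ map (suc a ↑ʳ_) (allFin b)
        ≡⟨ cong (_++ map (suc a ↑ʳ_) (allFin b))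
             (trans (map-tabulate (λ i → i) (suc ∘ (_↑ˡ b))) (sym (map-tabulate suc (_↑ˡ b)))) ⟩
      map (_↑ˡ b) (tabulate suc) ++ map (suc a ↑ʳ_) (allFin b) ∎)

  sum-omitting : ∀ m (y : Fin (suc m)) (f : Fin (suc m) → ℕ) c →
    f y ≡ 0 → (∀ i → i ≢ y → f i ≡ c) → sum (map f (allFin (suc m))) ≡ m * c
  sum-omitting m zero f c fy≡0 f≡c = cong₂ _+_ fy≡0 (begin
    sum (map f (tabulate suc))       ≡⟨ cong sum (trans (map-tabulate suc f) (sym (map-tabulate (λ i → i) (f ∘ suc)))) ⟩
    sum (map (f ∘ suc) (allFin m))   ≡⟨ sum-map-const (f ∘ suc) c (λ i → f≡c (suc i) λ ()) (allFin m) ⟩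
    length (allFin m) * c            ≡⟨ cong (_* c) (length-tabulate {n = m} (λ i → i)) ⟩
    m * c                            ∎)
    where open ≡-Reasoning
  sum-omitting (suc m) (suc y) f c fy≡0 f≡c = cong₂ _+_ (f≡c zero λ ()) (begin
    sum (map f (tabulate suc))            ≡⟨ cong sum (trans (map-tabulate suc f) (sym (map-tabulate (λ i → i) (f ∘ suc)))) ⟩
    sum (map (f ∘ suc) (allFin (suc m)))  ≡⟨ sum-omitting m y (f ∘ suc) c fy≡0 (λ i i≢y → f≡c (suc i) (i≢y ∘ Fin.suc-injective)) ⟩
    m * c                                 ∎)
    where open ≡-Reasoning

  -- `y` is a coordinate function and not a numbered space, so that the induction on the dimension
  -- can continue with `y ∘ suc`.
  Avoids : ∀ {k n} → (Fin k → Fin n) → Fin (n ^ k) → Set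
  Avoids y a = ¬ ∃ λ i → y i ≡ finToFun a i

  avoids? : ∀ {k n} (y : Fin k → Fin n) → Decidable (Avoids y)
  avoids? y a = ¬? (Fin.any? λ i → y i Fin.≟ finToFun a i)

  -- `finToFun` decodes `combine i j` as the first coordinate `i` followed by the decoding of `j`,
  -- so the board falls into rows by first coordinate. The row of `y zero` contributes nothing, and
  -- each of the other `m` rows is the same problem in one dimension less.
  count-avoiding : ∀ k m (y : Fin k → Fin (suc m)) → count (avoids? y) (allFin (suc m ^ k)) ≡ m ^ k
  count-avoiding zero    m y = refl
  count-avoiding (suc k) m y = trans (count-combine (suc m) (suc m ^ k) (avoids? y))
    (sum-omitting m (y zero) row (m ^ k)
      (count-none (λ j → avoids? y (combine (y zero) j)) (λ j h → h (zero , sym (head-combine (y zero) j))) (allFin (suc m ^ k)))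
      (λ i i≢y → trans
        (count-≐ (λ j → avoids? y (combine i j)) (avoids? (y ∘ suc))
          ( (λ {j} h (l , e) → h (suc l , trans e (sym (tail-combine i j l))))
          , (λ {j} → λ { h (zero , e) → i≢y (sym (trans e (head-combine i j)))
                       ; h (suc l , e) → h (l , trans e (tail-combine i j l)) }))
          (allFin (suc m ^ k)))
        (count-avoiding k m (y ∘ suc))))
    where
    row : Fin (suc m) → ℕ
    row i = count (λ j → avoids? y (combine i j)) (allFin (suc m ^ k))
    head-combine : ∀ i (j : Fin (suc m ^ k)) → finToFun {suc m} {suc k} (combine i j) zero ≡ i
    head-combine i j = cong proj₁ (Fin.remQuot-combine i j)
    tail-combine : ∀ i (j : Fin (suc m ^ k)) l → finToFun {suc m} {suc k} (combine i j) (suc l) ≡ finToFun j l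
    tail-combine i j l = cong (λ q → finToFun (proj₂ q) l) (Fin.remQuot-combine i j)

  -- Exact probability and expectation of safety

  module _ (k m : ℕ) where
    open Board (suc k) (suc m)

    private
      n = suc m
      N = n ^ suc k

    count-safe : ∀ x → count (λ p → safe? p x) configurations ≡ (m ^ suc k) C n
    count-safe x = begin
      count (λ p → safe? p x) configurations
        ≡⟨ count-filter (λ p → safe? p x) (λ p → card p ≟ n) (allSubsets N) ⟩
      count (λ p → (card p ≟ n) ×-dec safe? p x) (allSubsets N)
        ≡⟨ count-≐ _ (λ p → (card p ≟ n) ×-dec ⊆? (avoids? (coord x)) p)
             ( (λ (e , (_ , h)) → e , h)
             -- A piece standing on `x` agrees with `x` in coordinate `zero`, so avoidance already
             -- implies that `x` is unoccupied. The dimension `suc k` guarantees such a coordinate.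
             , (λ (e , h) → e , (λ x∈p → h x x∈p (zero , refl)) , h)) (allSubsets N) ⟩
      count (λ p → (card p ≟ n) ×-dec ⊆? (avoids? (coord x)) p) (allSubsets N)
        ≡⟨ subsets-within N (avoids? (coord x)) n ⟩
      count (avoids? (coord x)) (allFin N) C n
        ≡⟨ cong (_C n) (count-avoiding (suc k) m (coord x)) ⟩
      (m ^ suc k) C n ∎
      where open ≡-Reasoning

    length-configurations : length configurations ≡ N C n
    length-configurations = begin
      count (λ p → card p ≟ n) (allSubsets N)
        ≡⟨ count-≐ (λ p → card p ≟ n) (λ p → (card p ≟ n) ×-dec ⊆? (λ _ → yes tt) p)
             ((λ e → e , λ _ _ → tt) , proj₁) (allSubsets N) ⟩
      count (λ p → (card p ≟ n) ×-dec ⊆? (λ _ → yes tt) p) (allSubsets N)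
        ≡⟨ subsets-within N (λ _ → yes tt) n ⟩
      count (λ _ → yes tt) (allFin N) C n
        ≡⟨ cong (_C n) (trans (cong length (filter-all (λ _ → yes tt) (All.universal (λ _ → tt) (allFin N)))) (length-tabulate {n = N} (λ i → i))) ⟩
      N C n ∎
      where open ≡-Reasoning

    total-safe : sum (map safeCount configurations) ≡ N * ((m ^ suc k) C n)
    total-safe = begin
      sum (map safeCount configurations)
        ≡⟨ sum-count-swap safe? configurations (allFin N) ⟩
      sum (map (λ x → count (λ p → safe? p x) configurations) (allFin N))
        ≡⟨ sum-map-const _ ((m ^ suc k) C n) count-safe (allFin N) ⟩
      length (allFin N) * ((m ^ suc k) C n)
        ≡⟨ cong (_* ((m ^ suc k) C n)) (length-tabulate {n = N} (λ i → i)) ⟩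
      N * ((m ^ suc k) C n) ∎
      where open ≡-Reasoning

module Asymptotics where

  open Counting using (count-safe; length-configurations; total-safe)
  open import Algebra.Bundles using (CommutativeRing)
  open import Data.Integer.Base as ℤ using (+_)
  import Data.Integer.Properties as ℤ
  open import Data.Nat.Base as ℕ using (ℕ; zero; suc)
  open import Data.Nat.Combinatorics using (_C_; nCk+nC[k+1]≡[n+1]C[k+1])
  import Data.Nat.Properties as ℕ
  import Data.Nat.Solver as ℕ
  open import Data.Product.Base using (_×_; _,_; proj₁; proj₂)
  open import Data.Rational.Base
  open import Data.Rational.Properties
  open import Data.Rational.Solver using (module +-*-Solver)
  import Data.Rational.Unnormalised.Base as ℚᵘ
  import Data.Rational.Unnormalised.Properties as ℚᵘ
  open import Relation.Binary.PropositionalEquality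
    using (_≡_; refl; sym; trans; cong; cong₂; subst; subst₂; module ≡-Reasoning)
  open ℚ-Lemmas
  open Recip-Lemmas
  open ExpSum-Lemmas
  open import Algebra.Properties.CommutativeSemiring.Exp
    (CommutativeRing.commutativeSemiring +-*-commutativeRing)
    using (_^_; ^-distrib-*; ^-assocʳ)

  -- Natural numbers in ℚ, nonnegativity and powers

  ι : ℕ → ℚ
  ι n = + n / 1

  ι-+ : ∀ a b → ι (a ℕ.+ b) ≡ ι a + ι b
  ι-+ a b = toℚᵘ-injective (begin
    toℚᵘ (ι (a ℕ.+ b))                     ≈⟨ toℚᵘ-fromℚᵘ (ℚᵘ.mkℚᵘ (+ (a ℕ.+ b)) 0) ⟩
    ℚᵘ.mkℚᵘ (+ (a ℕ.+ b)) 0                ≈⟨ ℚᵘ.*≡* (cong (ℤ._* + 1) (cong₂ ℤ._+_ (ℤ.*-identityʳ (+ a)) (ℤ.*-identityʳ (+ b)))) ⟨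
    ℚᵘ.mkℚᵘ (+ a) 0 ℚᵘ.+ ℚᵘ.mkℚᵘ (+ b) 0   ≈⟨ ℚᵘ.+-cong (toℚᵘ-fromℚᵘ (ℚᵘ.mkℚᵘ (+ a) 0)) (toℚᵘ-fromℚᵘ (ℚᵘ.mkℚᵘ (+ b) 0)) ⟨
    toℚᵘ (ι a) ℚᵘ.+ toℚᵘ (ι b)             ≈⟨ toℚᵘ-homo-+ (ι a) (ι b) ⟨
    toℚᵘ (ι a + ι b)                       ∎)
    where open ℚᵘ.≃-Reasoning

  ι-* : ∀ a b → ι (a ℕ.* b) ≡ ι a * ι b
  ι-* a b = toℚᵘ-injective (begin
    toℚᵘ (ι (a ℕ.* b))                     ≈⟨ toℚᵘ-fromℚᵘ (ℚᵘ.mkℚᵘ (+ (a ℕ.* b)) 0) ⟩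
    ℚᵘ.mkℚᵘ (+ (a ℕ.* b)) 0                ≈⟨ ℚᵘ.*≡* (cong (ℤ._* + 1) (ℤ.pos-* a b)) ⟩
    ℚᵘ.mkℚᵘ (+ a) 0 ℚᵘ.* ℚᵘ.mkℚᵘ (+ b) 0   ≈⟨ ℚᵘ.*-cong (toℚᵘ-fromℚᵘ (ℚᵘ.mkℚᵘ (+ a) 0)) (toℚᵘ-fromℚᵘ (ℚᵘ.mkℚᵘ (+ b) 0)) ⟨
    toℚᵘ (ι a) ℚᵘ.* toℚᵘ (ι b)             ≈⟨ toℚᵘ-homo-* (ι a) (ι b) ⟨
    toℚᵘ (ι a * ι b)                       ∎)
    where open ℚᵘ.≃-Reasoning

  ι-suc : ∀ a → ι (suc a) ≡ 1ℚ + ι a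
  ι-suc a = ι-+ 1 a

  ι-^ : ∀ a k → ι (a ℕ.^ k) ≡ ι a ^ k
  ι-^ a zero    = refl
  ι-^ a (suc k) = trans (ι-* a (a ℕ.^ k)) (cong (ι a *_) (ι-^ a k))

  0≤ι : ∀ n → 0ℚ ≤ ι n
  0≤ι n = nonNegative⁻¹ (ι n) {{normalize-nonNeg n 1}}

  0<ι : ∀ n → 0ℚ < ι (suc n)
  0<ι n = positive⁻¹ (ι (suc n)) {{normalize-pos (suc n) 1}}

  ι-mono : ∀ {a b} → a ℕ.≤ b → ι a ≤ ι b
  ι-mono {a} {b} a≤b = subst₂ _≤_ (+-identityʳ (ι a))
    (trans (sym (ι-+ a (b ℕ.∸ a))) (cong ι (ℕ.m+[n∸m]≡n a≤b)))
    (+-monoʳ-≤ (ι a) (0≤ι (b ℕ.∸ a)))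

  quot-ι : ∀ a b → quot a (suc b) * ι (suc b) ≡ ι a
  quot-ι a b = toℚᵘ-injective (begin
    toℚᵘ (+ a / suc b * ι (suc b))                   ≈⟨ toℚᵘ-homo-* (+ a / suc b) (ι (suc b)) ⟩
    toℚᵘ (+ a / suc b) ℚᵘ.* toℚᵘ (ι (suc b))         ≈⟨ ℚᵘ.*-cong (toℚᵘ-fromℚᵘ (ℚᵘ.mkℚᵘ (+ a) b)) (toℚᵘ-fromℚᵘ (ℚᵘ.mkℚᵘ (+ suc b) 0)) ⟩
    ℚᵘ.mkℚᵘ (+ a) b ℚᵘ.* ℚᵘ.mkℚᵘ (+ suc b) 0         ≈⟨ ℚᵘ.*≡* (trans (ℤ.*-identityʳ (+ a ℤ.* + suc b)) (cong (+ a ℤ.*_) (sym (ℤ.*-identityʳ (+ suc b))))) ⟩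
    ℚᵘ.mkℚᵘ (+ a) 0                                  ≈⟨ toℚᵘ-fromℚᵘ (ℚᵘ.mkℚᵘ (+ a) 0) ⟨
    toℚᵘ (ι a)                                       ∎)
    where open ℚᵘ.≃-Reasoning

  ι*1/ : ∀ n → ι (suc n) * (+ 1 / suc n) ≡ 1ℚ
  ι*1/ n = trans (*-comm (ι (suc n)) (+ 1 / suc n)) (quot-ι 1 n)

  0≤+ : ∀ {p q} → 0ℚ ≤ p → 0ℚ ≤ q → 0ℚ ≤ p + q
  0≤+ = +-mono-≤ {0ℚ} {_} {0ℚ}

  0≤* : ∀ {p q} → 0ℚ ≤ p → 0ℚ ≤ q → 0ℚ ≤ p * q
  0≤* {p} {q} 0≤p 0≤q =
    nonNegative⁻¹ (p * q) {{nonNeg*nonNeg⇒nonNeg p {{nonNegative 0≤p}} q {{nonNegative 0≤q}}}}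

  ≤⇒0≤ : ∀ {p q} → p ≤ q → 0ℚ ≤ q - p
  ≤⇒0≤ {p} {q} p≤q = subst (_≤ q - p) (+-inverseʳ p) (+-monoˡ-≤ (- p) p≤q)

  0≤⇒≤ : ∀ {p q} → 0ℚ ≤ q - p → p ≤ q
  0≤⇒≤ {p} {q} h = subst₂ _≤_ (+-identityˡ p) (lem q p) (+-monoˡ-≤ p h)
    where
    open +-*-Solver
    lem : ∀ q p → q - p + p ≡ q
    lem = solve 2 (λ q p → q :- p :+ p := q) refl

  -- The recurrences below determine only a positive multiple of the next quantity. Inequalities are
  -- therefore proved by writing that multiple of the slack as a sum of products of nonnegative
  -- factors, and then dividing.
  0≤-cancel : ∀ s x → 0ℚ < s → 0ℚ ≤ s * x → 0ℚ ≤ x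
  0≤-cancel s x 0<s h = *-cancelˡ-≤-pos s {{positive 0<s}} (subst (_≤ s * x) (sym (*-zeroʳ s)) h)

  0≤^ : ∀ {x} → 0ℚ ≤ x → ∀ k → 0ℚ ≤ x ^ k
  0≤^ 0≤x zero    = <⇒≤ 0<1
  0≤^ 0≤x (suc k) = 0≤* 0≤x (0≤^ 0≤x k)

  ^-mono-≤ : ∀ {x y} → 0ℚ ≤ x → x ≤ y → ∀ k → x ^ k ≤ y ^ k
  ^-mono-≤ 0≤x x≤y zero    = ≤-refl
  ^-mono-≤ {x} {y} 0≤x x≤y (suc k) =
    *-mono-≤ x y (x ^ k) (y ^ k) (≤-trans 0≤x x≤y) (0≤^ 0≤x k) x≤y (^-mono-≤ 0≤x x≤y k)

  1^k≡1 : ∀ k → 1ℚ ^ k ≡ 1ℚ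
  1^k≡1 zero    = refl
  1^k≡1 (suc k) = trans (*-identityˡ (1ℚ ^ k)) (1^k≡1 k)

  ^≤1 : ∀ {x} → 0ℚ ≤ x → x ≤ 1ℚ → ∀ k → x ^ k ≤ 1ℚ
  ^≤1 {x} 0≤x x≤1 k = subst (x ^ k ≤_) (1^k≡1 k) (^-mono-≤ 0≤x x≤1 k)

  -- Bernoulli's inequality in terms of the shortfall from 1. Each step increases the slack by
  -- `(1ℚ - x) * (1ℚ - x ^ k)`, a product of nonnegative factors.
  bernoulli : ∀ {x} → 0ℚ ≤ x → x ≤ 1ℚ → ∀ k → 1ℚ - x ^ k ≤ ι k * (1ℚ - x)
  bernoulli {x} 0≤x x≤1 zero    = 0≤⇒≤ (≤-reflexive (lem x))
    where
    open +-*-Solver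
    lem : ∀ x → 0ℚ ≡ 0ℚ * (1ℚ - x) - (1ℚ - 1ℚ)
    lem = solve 1 (λ x → con 0ℚ := con 0ℚ :* (con 1ℚ :- x) :- (con 1ℚ :- con 1ℚ)) refl
  bernoulli {x} 0≤x x≤1 (suc k) = 0≤⇒≤ (subst (0ℚ ≤_) (sym eq)
    (0≤+ (≤⇒0≤ (bernoulli 0≤x x≤1 k)) (0≤* (≤⇒0≤ x≤1) (≤⇒0≤ (^≤1 0≤x x≤1 k)))))
    where
    open +-*-Solver
    lem : ∀ x X c → (1ℚ + c) * (1ℚ - x) - (1ℚ - x * X) ≡ (c * (1ℚ - x) - (1ℚ - X)) + (1ℚ - x) * (1ℚ - X)
    lem = solve 3 (λ x X c → (con 1ℚ :+ c) :* (con 1ℚ :- x) :- (con 1ℚ :- x :* X)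
                          := (c :* (con 1ℚ :- x) :- (con 1ℚ :- X)) :+ (con 1ℚ :- x) :* (con 1ℚ :- X)) refl
    eq : ι (suc k) * (1ℚ - x) - (1ℚ - x ^ suc k) ≡ (ι k * (1ℚ - x) - (1ℚ - x ^ k)) + (1ℚ - x) * (1ℚ - x ^ k)
    eq = trans (cong (λ s → s * (1ℚ - x) - (1ℚ - x ^ suc k)) (ι-suc k)) (lem x (x ^ k) (ι k))

  -- Ratios of binomial coefficients

  C-absorption : ∀ n k → suc k ℕ.* (n C suc k) ℕ.+ k ℕ.* (n C k) ≡ n ℕ.* (n C k)
  C-absorption zero    zero    = refl
  C-absorption zero    (suc k) = cong₂ ℕ._+_ (ℕ.*-zeroʳ (suc (suc k))) (ℕ.*-zeroʳ (suc k))
  C-absorption (suc n) zero    = begin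
    1 ℕ.* (suc n C 1) ℕ.+ 0        ≡⟨ cong (λ t → 1 ℕ.* t ℕ.+ 0) (nCk+nC[k+1]≡[n+1]C[k+1] n 0) ⟨
    1 ℕ.* (1 ℕ.+ n C 1) ℕ.+ 0      ≡⟨ cong suc (C-absorption n 0) ⟩
    suc n ℕ.* 1                    ∎
    where open ≡-Reasoning
  C-absorption (suc n) (suc k) = begin
    suc (suc k) ℕ.* (suc n C suc (suc k)) ℕ.+ suc k ℕ.* (suc n C suc k)
      ≡⟨ cong₂ (λ s t → suc (suc k) ℕ.* s ℕ.+ suc k ℕ.* t)
           (nCk+nC[k+1]≡[n+1]C[k+1] n (suc k)) (nCk+nC[k+1]≡[n+1]C[k+1] n k) ⟨
    suc (suc k) ℕ.* (y ℕ.+ z) ℕ.+ suc k ℕ.* (x ℕ.+ y)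
      ≡⟨ regroup k x y z ⟩
    (suc (suc k) ℕ.* z ℕ.+ suc k ℕ.* y) ℕ.+ (suc k ℕ.* y ℕ.+ k ℕ.* x) ℕ.+ (x ℕ.+ y)
      ≡⟨ cong₂ (λ s t → s ℕ.+ t ℕ.+ (x ℕ.+ y)) (C-absorption n (suc k)) (C-absorption n k) ⟩
    n ℕ.* y ℕ.+ n ℕ.* x ℕ.+ (x ℕ.+ y)
      ≡⟨ collect n x y ⟩
    suc n ℕ.* (x ℕ.+ y)
      ≡⟨ cong (suc n ℕ.*_) (nCk+nC[k+1]≡[n+1]C[k+1] n k) ⟩
    suc n ℕ.* (suc n C suc k) ∎
    where
    open ≡-Reasoning
    open ℕ.+-*-Solver
    x = n C k
    y = n C suc k
    z = n C suc (suc k)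
    regroup : ∀ k x y z → suc (suc k) ℕ.* (y ℕ.+ z) ℕ.+ suc k ℕ.* (x ℕ.+ y)
            ≡ (suc (suc k) ℕ.* z ℕ.+ suc k ℕ.* y) ℕ.+ (suc k ℕ.* y ℕ.+ k ℕ.* x) ℕ.+ (x ℕ.+ y)
    regroup = solve 4 (λ k x y z → (con 2 :+ k) :* (y :+ z) :+ (con 1 :+ k) :* (x :+ y)
      := ((con 2 :+ k) :* z :+ (con 1 :+ k) :* y) :+ ((con 1 :+ k) :* y :+ k :* x) :+ (x :+ y)) refl
    collect : ∀ n x y → n ℕ.* y ℕ.+ n ℕ.* x ℕ.+ (x ℕ.+ y) ≡ suc n ℕ.* (x ℕ.+ y)
    collect = solve 3 (λ n x y → n :* y :+ n :* x :+ (x :+ y) := (con 1 :+ n) :* (x :+ y)) refl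

  C-positive : ∀ {n k} → k ℕ.≤ n → 0 ℕ.< n C k
  C-positive {n}     {zero}  _           = ℕ.s≤s ℕ.z≤n
  C-positive {suc n} {suc k} (ℕ.s≤s k≤n) = subst (0 ℕ.<_) (nCk+nC[k+1]≡[n+1]C[k+1] n k)
    (ℕ.≤-trans (C-positive k≤n) (ℕ.m≤m+n (n C k) (n C suc k)))

  -- The absorption identity is proved additively over ℕ, away from truncated subtraction, and the
  -- subtraction is made here in ℚ.
  C-step : ∀ n k → ι (suc k) * ι (n C suc k) ≡ (ι n - ι k) * ι (n C k)
  C-step n k = begin
    ι (suc k) * ι (n C suc k)
      ≡⟨ add-sub (ι (suc k) * ι (n C suc k)) (ι k * ι (n C k)) ⟩
    ι (suc k) * ι (n C suc k) + ι k * ι (n C k) - ι k * ι (n C k)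
      ≡⟨ cong (_- ι k * ι (n C k)) absorption ⟩
    ι n * ι (n C k) - ι k * ι (n C k)
      ≡⟨ factor (ι n) (ι k) (ι (n C k)) ⟩
    (ι n - ι k) * ι (n C k) ∎
    where
    open ≡-Reasoning
    open +-*-Solver
    add-sub : ∀ p q → p ≡ p + q - q
    add-sub = solve 2 (λ p q → p := p :+ q :- q) refl
    factor : ∀ a b c → a * c - b * c ≡ (a - b) * c
    factor = solve 3 (λ a b c → a :* c :- b :* c := (a :- b) :* c) refl
    absorption : ι (suc k) * ι (n C suc k) + ι k * ι (n C k) ≡ ι n * ι (n C k)
    absorption = begin
      ι (suc k) * ι (n C suc k) + ι k * ι (n C k)
        ≡⟨ cong₂ _+_ (ι-* (suc k) (n C suc k)) (ι-* k (n C k)) ⟨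
      ι (suc k ℕ.* (n C suc k)) + ι (k ℕ.* (n C k))
        ≡⟨ ι-+ (suc k ℕ.* (n C suc k)) (k ℕ.* (n C k)) ⟨
      ι (suc k ℕ.* (n C suc k) ℕ.+ k ℕ.* (n C k))
        ≡⟨ cong ι (C-absorption n k) ⟩
      ι (n ℕ.* (n C k))
        ≡⟨ ι-* n (n C k) ⟩
      ι n * ι (n C k) ∎

  -- C(M,n)/C(N,n) is the product of the (M-i)/(N-i) for i < n, each of which
  -- falls short of ρ = M/N by i(1-ρ)/(N-i) ≤ κ.
  module BinomialRatio
    (M N n : ℕ) (n≤N : n ℕ.≤ N) (ρ κ : ℚ)
    (0≤ρ : 0ℚ ≤ ρ) (ρ≤1 : ρ ≤ 1ℚ) (0≤κ : 0ℚ ≤ κ) (ρN≡M : ρ * ι N ≡ ι M)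
    (deficit : ∀ i → i ℕ.< n → ι i * (1ℚ - ρ) ≤ κ * (ι N - ι i))
    where

    private
      -- `gap i` is `B i` times the excess of ρ^i over C(M,i)/C(N,i). Clearing the denominator makes
      -- its recurrence linear.
      A B gap : ℕ → ℚ
      A i = ι (M C i)
      B i = ι (N C i)
      gap i = ρ ^ i * B i - A i

    -- Apply `C-step` to both coefficients. The last term arises from
    -- `ρ * (ι N - ι i) - (ι M - ι i)`, which equals `ι i * (1ℚ - ρ)` because ρN = M.
    gap-step : ∀ i → ι (suc i) * gap (suc i) ≡ ρ * (ι N - ι i) * gap i + ι i * (1ℚ - ρ) * A i
    gap-step i = begin
      ι (suc i) * gap (suc i)
        ≡⟨ distribute (ι (suc i)) ρ (ρ ^ i) (B (suc i)) (A (suc i)) ⟩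
      ρ * ρ ^ i * (ι (suc i) * B (suc i)) - ι (suc i) * A (suc i)
        ≡⟨ cong₂ (λ s t → ρ * ρ ^ i * s - t) (C-step N i)
             (trans (C-step M i) (cong (λ t → (t - ι i) * A i) (sym ρN≡M))) ⟩
      ρ * ρ ^ i * ((ι N - ι i) * B i) - (ρ * ι N - ι i) * A i
        ≡⟨ collect ρ (ρ ^ i) (ι N) (ι i) (A i) (B i) ⟩
      ρ * (ι N - ι i) * gap i + ι i * (1ℚ - ρ) * A i ∎
      where
      open ≡-Reasoning
      open +-*-Solver
      distribute : ∀ s r R b a → s * (r * R * b - a) ≡ r * R * (s * b) - s * a
      distribute = solve 5 (λ s r R b a → s :* (r :* R :* b :- a) := r :* R :* (s :* b) :- s :* a) refl
      collect : ∀ r R n i a b → r * R * ((n - i) * b) - (r * n - i) * a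
              ≡ r * (n - i) * (R * b - a) + i * (1ℚ - r) * a
      collect = solve 6 (λ r R n i a b → r :* R :* ((n :- i) :* b) :- (r :* n :- i) :* a
              := r :* (n :- i) :* (R :* b :- a) :+ i :* (con 1ℚ :- r) :* a) refl

    0≤N-i : ∀ i → i ℕ.≤ n → 0ℚ ≤ ι N - ι i
    0≤N-i i i≤n = ≤⇒0≤ (ι-mono (ℕ.≤-trans i≤n n≤N))

    0≤gap : ∀ i → i ℕ.≤ n → 0ℚ ≤ gap i
    0≤gap zero    _   = ≤-refl
    0≤gap (suc i) i<n = 0≤-cancel (ι (suc i)) (gap (suc i)) (0<ι i) (subst (0ℚ ≤_) (sym (gap-step i))
      (0≤+ (0≤* (0≤* 0≤ρ (0≤N-i i (ℕ.<⇒≤ i<n))) (0≤gap i (ℕ.<⇒≤ i<n)))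
           (0≤* (0≤* (0≤ι i) (≤⇒0≤ ρ≤1)) (0≤ι (M C i)))))

    A≤B : ∀ i → i ℕ.≤ n → A i ≤ B i
    A≤B i i≤n = 0≤⇒≤ (subst (0ℚ ≤_) (sym (split (ρ ^ i) (A i) (B i)))
      (0≤+ (0≤* (≤⇒0≤ (^≤1 0≤ρ ρ≤1 i)) (0≤ι (N C i))) (0≤gap i i≤n)))
      where
      open +-*-Solver
      split : ∀ R a b → b - a ≡ (1ℚ - R) * b + (R * b - a)
      split = solve 3 (λ R a b → b :- a := (con 1ℚ :- R) :* b :+ (R :* b :- a)) refl

    -- In a product of factors at most 1, replacing them one by one costs at most κ each. After
    -- clearing denominators, the four terms of `slack` are nonnegative by the induction hypothesis,
    -- by ρ ≤ 1, by `deficit` and by `A≤B`, respectively.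
    gap-upper : ∀ i → i ℕ.≤ n → gap i ≤ ι i * κ * B i
    gap-upper zero    _   = 0≤⇒≤ (≤-reflexive (base κ))
      where
      open +-*-Solver
      base : ∀ k → 0ℚ ≡ 0ℚ * k * 1ℚ - (1ℚ * 1ℚ - 1ℚ)
      base = solve 1 (λ k → con 0ℚ := con 0ℚ :* k :* con 1ℚ :- (con 1ℚ :* con 1ℚ :- con 1ℚ)) refl
    gap-upper (suc i) i<n = 0≤⇒≤ (0≤-cancel (ι (suc i)) _ (0<ι i) (subst (0ℚ ≤_) (sym slack)
      (0≤+ (0≤+ (0≤+ (0≤* 0≤d (≤⇒0≤ (gap-upper i i≤n)))
                     (0≤* (0≤* (≤⇒0≤ ρ≤1) 0≤d) (0≤gap i i≤n)))
                (0≤* (≤⇒0≤ (deficit i i<n)) (0≤ι (M C i))))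
           (0≤* (0≤* 0≤κ 0≤d) (≤⇒0≤ (A≤B i i≤n))))))
      where
      open ≡-Reasoning
      open +-*-Solver
      i≤n = ℕ.<⇒≤ i<n
      d = ι N - ι i
      0≤d = 0≤N-i i i≤n
      distribute : ∀ s k b g → s * (s * k * b - g) ≡ s * k * (s * b) - s * g
      distribute = solve 4 (λ s k b g → s :* (s :* k :* b :- g) := s :* k :* (s :* b) :- s :* g) refl
      collect : ∀ k d r i a b g → (1ℚ + i) * k * (d * b) - (r * d * g + i * (1ℚ - r) * a)
        ≡ d * (i * k * b - g) + (1ℚ - r) * d * g + (k * d - i * (1ℚ - r)) * a + k * d * (b - a)
      collect = solve 7 (λ k d r i a b g →
        (con 1ℚ :+ i) :* k :* (d :* b) :- (r :* d :* g :+ i :* (con 1ℚ :- r) :* a)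
        := d :* (i :* k :* b :- g) :+ (con 1ℚ :- r) :* d :* g
           :+ (k :* d :- i :* (con 1ℚ :- r)) :* a :+ k :* d :* (b :- a)) refl
      slack : ι (suc i) * (ι (suc i) * κ * B (suc i) - gap (suc i))
        ≡ d * (ι i * κ * B i - gap i) + (1ℚ - ρ) * d * gap i
          + (κ * d - ι i * (1ℚ - ρ)) * A i + κ * d * (B i - A i)
      slack = begin
        ι (suc i) * (ι (suc i) * κ * B (suc i) - gap (suc i))
          ≡⟨ distribute (ι (suc i)) κ (B (suc i)) (gap (suc i)) ⟩
        ι (suc i) * κ * (ι (suc i) * B (suc i)) - ι (suc i) * gap (suc i)
          ≡⟨ cong₂ _-_ (cong₂ (λ s t → s * κ * t) (ι-suc i) (C-step N i)) (gap-step i) ⟩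
        (1ℚ + ι i) * κ * (d * B i) - (ρ * d * gap i + ι i * (1ℚ - ρ) * A i)
          ≡⟨ collect κ d ρ (ι i) (A i) (B i) (gap i) ⟩
        d * (ι i * κ * B i - gap i) + (1ℚ - ρ) * d * gap i
          + (κ * d - ι i * (1ℚ - ρ)) * A i + κ * d * (B i - A i) ∎

  -- The truncated exponential series

  expTerm expPoly : ℕ → ℚ → ℚ
  expTerm i t = invFactorial i * t ^ i
  expPoly zero    t = expTerm 0 t
  expPoly (suc J) t = expPoly J t + expTerm (suc J) t

  expTerm-suc : ∀ i t → ι (suc i) * expTerm (suc i) t ≡ t * expTerm i t
  expTerm-suc i t = begin
    ι (suc i) * (invFactorial (suc i) * (t * t ^ i))
      ≡⟨ cong (λ s → ι (suc i) * (s * (t * t ^ i))) (invFactorial-suc i) ⟩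
    ι (suc i) * ((+ 1 / suc i) * invFactorial i * (t * t ^ i))
      ≡⟨ regroup (ι (suc i)) (+ 1 / suc i) (invFactorial i) t (t ^ i) ⟩
    ι (suc i) * (+ 1 / suc i) * (t * (invFactorial i * t ^ i))
      ≡⟨ cong (_* (t * (invFactorial i * t ^ i))) (ι*1/ i) ⟩
    1ℚ * (t * (invFactorial i * t ^ i))
      ≡⟨ *-identityˡ _ ⟩
    t * (invFactorial i * t ^ i) ∎
    where
    open ≡-Reasoning
    open +-*-Solver
    regroup : ∀ s r f t T → s * (r * f * (t * T)) ≡ s * r * (t * (f * T))
    regroup = solve 5 (λ s r f t T → s :* (r :* f :* (t :* T)) := s :* r :* (t :* (f :* T))) refl

  0≤expTerm : ∀ i {t} → 0ℚ ≤ t → 0ℚ ≤ expTerm i t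
  0≤expTerm i 0≤t = 0≤* (0≤invFactorial i) (0≤^ 0≤t i)

  expPoly-1 : ∀ J → expPoly J 1ℚ ≡ expSum J
  expPoly-1 zero    = refl
  expPoly-1 (suc J) = cong₂ _+_ (expPoly-1 J)
    (trans (cong (invFactorial (suc J) *_) (1^k≡1 (suc J))) (*-identityʳ (invFactorial (suc J))))

  expPoly-0 : ∀ J → expPoly J 0ℚ ≡ 1ℚ
  expPoly-0 zero    = refl
  expPoly-0 (suc J) = trans
    (cong₂ _+_ (expPoly-0 J)
      (trans (cong (invFactorial (suc J) *_) (*-zeroˡ (0ℚ ^ J))) (*-zeroʳ (invFactorial (suc J)))))
    (+-identityʳ 1ℚ)

  module _ {t h : ℚ} (0≤t : 0ℚ ≤ t) (0≤h : 0ℚ ≤ h) where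

    private
      u = t + h
      0≤u = 0≤+ 0≤t 0≤h
      Δ : ℕ → ℚ
      Δ i = expTerm i u - expTerm i t
      open +-*-Solver

      Δ-suc : ∀ i → ι (suc i) * Δ (suc i) ≡ t * Δ i + h * expTerm i u
      Δ-suc i = begin
        ι (suc i) * Δ (suc i)
          ≡⟨ distribute (ι (suc i)) (expTerm (suc i) u) (expTerm (suc i) t) ⟩
        ι (suc i) * expTerm (suc i) u - ι (suc i) * expTerm (suc i) t
          ≡⟨ cong₂ _-_ (expTerm-suc i u) (expTerm-suc i t) ⟩
        (t + h) * expTerm i u - t * expTerm i t
          ≡⟨ collect t h (expTerm i u) (expTerm i t) ⟩
        t * Δ i + h * expTerm i u ∎
        where
        open ≡-Reasoning
        distribute : ∀ s a b → s * (a - b) ≡ s * a - s * b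
        distribute = solve 3 (λ s a b → s :* (a :- b) := s :* a :- s :* b) refl
        collect : ∀ t h a b → (t + h) * a - t * b ≡ t * (a - b) + h * a
        collect = solve 4 (λ t h a b → (t :+ h) :* a :- t :* b := t :* (a :- b) :+ h :* a) refl

    -- The mean value estimate without calculus: `expTerm i` is the derivative of `expTerm (suc i)`
    -- and is increasing, so the increment over [t, t+h] lies between h times its values at the two
    -- ends. The induction uses only the recurrence `Δ-suc`.
    expTerm-increment : ∀ i → h * expTerm i t ≤ expTerm (suc i) u - expTerm (suc i) t
                            × expTerm (suc i) u - expTerm (suc i) t ≤ h * expTerm i u
    expTerm-increment zero = ≤-reflexive (sym Δ1) , ≤-reflexive Δ1
      where
      base : ∀ t h → t * (1ℚ * 1ℚ - 1ℚ * 1ℚ) + h * (1ℚ * 1ℚ) ≡ h * (1ℚ * 1ℚ)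
      base = solve 2 (λ t h → t :* (con 1ℚ :* con 1ℚ :- con 1ℚ :* con 1ℚ) :+ h :* (con 1ℚ :* con 1ℚ)
                           := h :* (con 1ℚ :* con 1ℚ)) refl
      Δ1 : Δ 1 ≡ h * expTerm 0 u
      Δ1 = trans (sym (*-identityˡ (Δ 1))) (trans (Δ-suc 0) (base t h))
    expTerm-increment (suc i) =
        0≤⇒≤ (0≤-cancel s _ (0<ι (suc i)) (subst (0ℚ ≤_) (sym lower-slack)
          -- That `Δ (suc i)` is nonnegative is read off from the lower bound in the induction
          -- hypothesis.
          (0≤+ (0≤* 0≤t (≤⇒0≤ (proj₁ IH))) (0≤* 0≤h (≤-trans (0≤* 0≤h (0≤expTerm i 0≤t)) (proj₁ IH))))))
      , 0≤⇒≤ (0≤-cancel s _ (0<ι (suc i)) (subst (0ℚ ≤_) (sym upper-slack)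
          (0≤+ (0≤* 0≤t (≤⇒0≤ (proj₂ IH))) (0≤* (0≤* 0≤h 0≤h) (0≤expTerm i 0≤u)))))
      where
      open ≡-Reasoning
      IH = expTerm-increment i
      s = ι (suc (suc i))
      a = ι (suc i)
      x = expTerm (suc i) u
      y = expTerm (suc i) t
      lower₁ : ∀ s h y D → s * (D - h * y) ≡ s * D - h * (s * y)
      lower₁ = solve 4 (λ s h y D → s :* (D :- h :* y) := s :* D :- h :* (s :* y)) refl
      lower₂ : ∀ a t h x y → t * (x - y) + h * x - h * ((1ℚ + a) * y) ≡ t * (x - y) + h * (x - y) - h * (a * y)
      lower₂ = solve 5 (λ a t h x y → t :* (x :- y) :+ h :* x :- h :* ((con 1ℚ :+ a) :* y)
                                   := t :* (x :- y) :+ h :* (x :- y) :- h :* (a :* y)) refl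
      lower₃ : ∀ t h D f → t * D + h * D - h * (t * f) ≡ t * (D - h * f) + h * D
      lower₃ = solve 4 (λ t h D f → t :* D :+ h :* D :- h :* (t :* f) := t :* (D :- h :* f) :+ h :* D) refl
      lower-slack : s * (Δ (suc (suc i)) - h * y) ≡ t * (Δ (suc i) - h * expTerm i t) + h * Δ (suc i)
      lower-slack = begin
        s * (Δ (suc (suc i)) - h * y)             ≡⟨ lower₁ s h y (Δ (suc (suc i))) ⟩
        s * Δ (suc (suc i)) - h * (s * y)         ≡⟨ cong₂ (λ p q → p - h * (q * y)) (Δ-suc (suc i)) (ι-suc (suc i)) ⟩
        t * (x - y) + h * x - h * ((1ℚ + a) * y)  ≡⟨ lower₂ a t h x y ⟩
        t * (x - y) + h * (x - y) - h * (a * y)   ≡⟨ cong (λ p → t * (x - y) + h * (x - y) - h * p) (expTerm-suc i t) ⟩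
        t * (x - y) + h * (x - y) - h * (t * expTerm i t) ≡⟨ lower₃ t h (x - y) (expTerm i t) ⟩
        t * (Δ (suc i) - h * expTerm i t) + h * Δ (suc i) ∎
      upper₁ : ∀ s h x D → s * (h * x - D) ≡ h * (s * x) - s * D
      upper₁ = solve 4 (λ s h x D → s :* (h :* x :- D) := h :* (s :* x) :- s :* D) refl
      upper₂ : ∀ a t h x D → h * ((1ℚ + a) * x) - (t * D + h * x) ≡ h * (a * x) - t * D
      upper₂ = solve 5 (λ a t h x D → h :* ((con 1ℚ :+ a) :* x) :- (t :* D :+ h :* x) := h :* (a :* x) :- t :* D) refl
      upper₃ : ∀ t h D f → h * ((t + h) * f) - t * D ≡ t * (h * f - D) + h * h * f
      upper₃ = solve 4 (λ t h D f → h :* ((t :+ h) :* f) :- t :* D := t :* (h :* f :- D) :+ h :* h :* f) refl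
      upper-slack : s * (h * x - Δ (suc (suc i))) ≡ t * (h * expTerm i u - Δ (suc i)) + h * h * expTerm i u
      upper-slack = begin
        s * (h * x - Δ (suc (suc i)))                   ≡⟨ upper₁ s h x (Δ (suc (suc i))) ⟩
        h * (s * x) - s * Δ (suc (suc i))               ≡⟨ cong₂ (λ p q → h * (p * x) - q) (ι-suc (suc i)) (Δ-suc (suc i)) ⟩
        h * ((1ℚ + a) * x) - (t * (x - y) + h * x)      ≡⟨ upper₂ a t h x (x - y) ⟩
        h * (a * x) - t * (x - y)                       ≡⟨ cong (λ p → h * p - t * (x - y)) (expTerm-suc i u) ⟩
        h * ((t + h) * expTerm i u) - t * (x - y)       ≡⟨ upper₃ t h (x - y) (expTerm i u) ⟩
        t * (h * expTerm i u - Δ (suc i)) + h * h * expTerm i u ∎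

    -- The difference `expPoly J - expTerm J` is the derivative of `expPoly J`; written this way it
    -- also covers J = 0. The bounds for the single terms are added up.
    expPoly-increment : ∀ J → h * (expPoly J t - expTerm J t) ≤ expPoly J u - expPoly J t
                            × expPoly J u - expPoly J t ≤ h * (expPoly J u - expTerm J u)
    expPoly-increment zero = ≤-reflexive (base h) , ≤-reflexive (sym (base h))
      where
      base : ∀ h → h * (1ℚ * 1ℚ - 1ℚ * 1ℚ) ≡ 1ℚ * 1ℚ - 1ℚ * 1ℚ
      base = solve 1 (λ h → h :* (con 1ℚ :* con 1ℚ :- con 1ℚ :* con 1ℚ) := con 1ℚ :* con 1ℚ :- con 1ℚ :* con 1ℚ) refl
    expPoly-increment (suc J) =
        subst₂ _≤_ (telescope h (expPoly J t) (expTerm J t) (expTerm (suc J) t)) split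
          (+-mono-≤ {h * (expPoly J t - expTerm J t)} (proj₁ IH) (proj₁ (expTerm-increment J)))
      , subst₂ _≤_ split (telescope h (expPoly J u) (expTerm J u) (expTerm (suc J) u))
          (+-mono-≤ {expPoly J u - expPoly J t} (proj₂ IH) (proj₂ (expTerm-increment J)))
      where
      IH = expPoly-increment J
      telescope : ∀ h F f g → h * (F - f) + h * f ≡ h * (F + g - g)
      telescope = solve 4 (λ h F f g → h :* (F :- f) :+ h :* f := h :* (F :+ g :- g)) refl
      exchange : ∀ a b c d → (a - b) + (c - d) ≡ a + c - (b + d)
      exchange = solve 4 (λ a b c d → (a :- b) :+ (c :- d) := a :+ c :- (b :+ d)) refl
      split : (expPoly J u - expPoly J t) + Δ (suc J) ≡ expPoly (suc J) u - expPoly (suc J) t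
      split = exchange (expPoly J u) (expPoly J t) (expTerm (suc J) u) (expTerm (suc J) t)

    -- The increment is at most h times the derivative at the right end, and restoring the missing
    -- last term only enlarges that bound.
    expPoly-decay : ∀ J → expPoly J u * (1ℚ - h) ≤ expPoly J t
    expPoly-decay J = 0≤⇒≤ (subst (0ℚ ≤_) (sym (slack h (expPoly J u) (expPoly J t) (expTerm J u)))
      (0≤+ (≤⇒0≤ (proj₂ (expPoly-increment J))) (0≤* 0≤h (0≤expTerm J 0≤u))))
      where
      slack : ∀ h F G f → G - F * (1ℚ - h) ≡ (h * (F - f) - (F - G)) + h * f
      slack = solve 4 (λ h F G f → G :- F :* (con 1ℚ :- h) := (h :* (F :- f) :- (F :- G)) :+ h :* f) refl

    -- The last term is doubled so that, for t ≤ 1, the sum decreases with J;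
    -- the truncated series itself grows too slowly in t.
    expPoly-growth : ∀ i → t ≤ 1ℚ → let J = suc (suc i) in
      (1ℚ + h) * (expPoly J t + expTerm J t) ≤ expPoly J u + expTerm J u
    expPoly-growth i t≤1 = 0≤⇒≤ (subst (0ℚ ≤_) (sym slack)
      (0≤+ (0≤+ (≤⇒0≤ (proj₁ (expPoly-increment (suc (suc i))))) (≤⇒0≤ (proj₁ (expTerm-increment (suc i)))))
           (0≤* 0≤h (0≤+ (0≤* (≤⇒0≤ t≤1) (0≤expTerm (suc i) 0≤t)) (0≤* (0≤ι i) (0≤expTerm (suc (suc i)) 0≤t))))))
      where
      open ≡-Reasoning
      F = expPoly (suc (suc i)) u
      G = expPoly (suc (suc i)) t
      f = expTerm (suc (suc i)) u
      g = expTerm (suc (suc i)) t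
      g₀ = expTerm (suc i) t
      rearrange : ∀ h F G f g g₀ → F + f - (1ℚ + h) * (G + g)
        ≡ ((F - G) - h * (G - g)) + ((f - g) - h * g₀) + h * (g₀ - (1ℚ + 1ℚ) * g)
      rearrange = solve 6 (λ h F G f g g₀ → F :+ f :- (con 1ℚ :+ h) :* (G :+ g)
        := ((F :- G) :- h :* (G :- g)) :+ ((f :- g) :- h :* g₀) :+ h :* (g₀ :- (con 1ℚ :+ con 1ℚ) :* g)) refl
      expand : ∀ g₀ g c → g₀ - (1ℚ + 1ℚ) * g ≡ g₀ - (1ℚ + (1ℚ + c)) * g + c * g
      expand = solve 3 (λ g₀ g c → g₀ :- (con 1ℚ :+ con 1ℚ) :* g := g₀ :- (con 1ℚ :+ (con 1ℚ :+ c)) :* g :+ c :* g) refl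
      factor : ∀ t g₀ r → g₀ - t * g₀ + r ≡ (1ℚ - t) * g₀ + r
      factor = solve 3 (λ t g₀ r → g₀ :- t :* g₀ :+ r := (con 1ℚ :- t) :* g₀ :+ r) refl
      -- G' ≥ G amounts to `g₀` being at least twice `g`. Since `ι (suc (suc i)) * g` equals
      -- `t * g₀`, this holds for t ≤ 1 once the degree is at least 2, which is why the degree has
      -- the form `suc (suc i)`.
      halving : g₀ - (1ℚ + 1ℚ) * g ≡ (1ℚ - t) * g₀ + ι i * g
      halving = begin
        g₀ - (1ℚ + 1ℚ) * g                         ≡⟨ expand g₀ g (ι i) ⟩
        g₀ - (1ℚ + (1ℚ + ι i)) * g + ι i * g       ≡⟨ cong (λ s → g₀ - s * g + ι i * g) (trans (ι-suc (suc i)) (cong (λ s → 1ℚ + s) (ι-suc i))) ⟨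
        g₀ - ι (suc (suc i)) * g + ι i * g         ≡⟨ cong (λ s → g₀ - s + ι i * g) (expTerm-suc (suc i) t) ⟩
        g₀ - t * g₀ + ι i * g                      ≡⟨ factor t g₀ (ι i * g) ⟩
        (1ℚ - t) * g₀ + ι i * g                    ∎
      slack : F + f - (1ℚ + h) * (G + g)
        ≡ ((F - G) - h * (G - g)) + ((f - g) - h * g₀) + h * ((1ℚ - t) * g₀ + ι i * g)
      slack = trans (rearrange h F G f g g₀) (cong (λ p → ((F - G) - h * (G - g)) + ((f - g) - h * g₀) + h * p) halving)

  -- Comparing (1 - 1/n)^n with the partial sums of e

  step ratio : ℕ → ℚ
  step m = + 1 / suc m
  ratio m = 1ℚ - step m

  0≤step : ∀ m → 0ℚ ≤ step m
  0≤step m = nonNegative⁻¹ (step m) {{normalize-nonNeg 1 (suc m)}}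

  0≤ratio : ∀ m → 0ℚ ≤ ratio m
  0≤ratio m = ≤⇒0≤ (1/suc-anti {0} {m} ℕ.z≤n)

  ratio≤1 : ∀ m → ratio m ≤ 1ℚ
  ratio≤1 m = 0≤⇒≤ (subst (0ℚ ≤_) (lem (step m)) (0≤step m))
    where
    open +-*-Solver
    lem : ∀ h → h ≡ 1ℚ - (1ℚ - h)
    lem = solve 1 (λ h → h := con 1ℚ :- (con 1ℚ :- h)) refl

  module _ (m : ℕ) where

    private
      n = suc m
      h = step m
      r = ratio m
      open +-*-Solver

      next : ∀ i → ι (suc i) * h ≡ ι i * h + h
      next i = trans (cong (_* h) (ι-suc i)) (lem (ι i) h)
        where
        lem : ∀ a h → (1ℚ + a) * h ≡ a * h + h
        lem = solve 2 (λ a h → (con 1ℚ :+ a) :* h := a :* h :+ h) refl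

      0≤node : ∀ i → 0ℚ ≤ ι i * h
      0≤node i = 0≤* (0≤ι i) (0≤step m)

      node≤1 : ∀ i → i ℕ.≤ n → ι i * h ≤ 1ℚ
      node≤1 i i≤n = subst (ι i * h ≤_) (ι*1/ m)
        (*-monoʳ-≤-nonNeg h {{nonNegative (0≤step m)}} (ι-mono i≤n))

    expPoly*ratio^≤1 : ∀ J i → expPoly J (ι i * h) * r ^ i ≤ 1ℚ
    expPoly*ratio^≤1 J zero    = ≤-reflexive (trans (*-identityʳ (expPoly J (0ℚ * h)))
      (trans (cong (expPoly J) (*-zeroˡ h)) (expPoly-0 J)))
    expPoly*ratio^≤1 J (suc i) = begin
      expPoly J (ι (suc i) * h) * (r * r ^ i)   ≡⟨ cong (λ t → expPoly J t * (r * r ^ i)) (next i) ⟩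
      expPoly J (ι i * h + h) * (r * r ^ i)     ≡⟨ *-assoc (expPoly J (ι i * h + h)) r (r ^ i) ⟨
      expPoly J (ι i * h + h) * r * r ^ i       ≤⟨ *-monoʳ-≤-nonNeg (r ^ i) {{nonNegative (0≤^ (0≤ratio m) i)}}
                                                     (expPoly-decay (0≤node i) (0≤step m) J) ⟩
      expPoly J (ι i * h) * r ^ i               ≤⟨ expPoly*ratio^≤1 J i ⟩
      1ℚ                                        ∎
      where open ≤-Reasoning

    [1+step]^≤expPoly : ∀ j i → i ℕ.≤ n → let J = suc (suc j) in
      (1ℚ + h) ^ i ≤ expPoly J (ι i * h) + expTerm J (ι i * h)
    [1+step]^≤expPoly j zero    _   = subst (_≤ expPoly J (0ℚ * h) + expTerm J (0ℚ * h))
      (trans (+-identityʳ (expPoly J (0ℚ * h))) (trans (cong (expPoly J) (*-zeroˡ h)) (expPoly-0 J)))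
      (+-monoʳ-≤ (expPoly J (0ℚ * h)) (0≤expTerm J (0≤node 0)))
      where J = suc (suc j)
    [1+step]^≤expPoly j (suc i) i<n = begin
      (1ℚ + h) * (1ℚ + h) ^ i
        ≤⟨ *-monoˡ-≤-nonNeg (1ℚ + h) {{nonNegative (0≤+ (<⇒≤ 0<1) (0≤step m))}} ([1+step]^≤expPoly j i (ℕ.<⇒≤ i<n)) ⟩
      (1ℚ + h) * (expPoly J (ι i * h) + expTerm J (ι i * h))
        ≤⟨ expPoly-growth (0≤node i) (0≤step m) j (node≤1 i (ℕ.<⇒≤ i<n)) ⟩
      expPoly J (ι i * h + h) + expTerm J (ι i * h + h)
        ≡⟨ cong (λ t → expPoly J t + expTerm J t) (next i) ⟨
      expPoly J (ι (suc i) * h) + expTerm J (ι (suc i) * h) ∎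
      where
      open ≤-Reasoning
      J = suc (suc j)

    ratio^*expSum≤1 : ∀ J → r ^ n * expSum J ≤ 1ℚ
    ratio^*expSum≤1 J = subst (_≤ 1ℚ)
      (trans (cong (λ t → expPoly J t * r ^ n) (ι*1/ m)) (trans (cong (_* r ^ n) (expPoly-1 J)) (*-comm (expSum J) (r ^ n))))
      (expPoly*ratio^≤1 J n)

    -- One `h` pays for the doubled last term, since 1/J! ≤ 1/J ≤ h, and the other for Bernoulli's
    -- loss n h² = h. The condition on J secures both this tail bound and, even at m = 0, the degree
    -- 2 that `expPoly-growth` demands.
    1-ratio^*expSum≤ : ∀ J → 2 ℕ.+ m ℕ.≤ J → 1ℚ - r ^ n * expSum J ≤ h + h
    1-ratio^*expSum≤ (suc (suc j)) (ℕ.s≤s m<J) = 0≤⇒≤ (subst (0ℚ ≤_) (sym (slack h (r ^ n) E f P))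
      (0≤+ (0≤+ (0≤+ (≤⇒0≤ tail) (0≤* (≤⇒0≤ (^≤1 (0≤ratio m) (ratio≤1 m) n)) (0≤invFactorial J)))
                (0≤* (0≤^ (0≤ratio m) n) (≤⇒0≤ growth)))
           (≤⇒0≤ product)))
      where
      J = suc (suc j)
      E = expSum J
      f = invFactorial J
      P = (1ℚ + h) ^ n
      tail : f ≤ h
      tail = ≤-trans (invFactorial≤1/ (suc j)) (1/suc-anti (ℕ.≤-trans (ℕ.n≤1+n m) m<J))
      growth : P ≤ E + f
      growth = subst (P ≤_)
        (trans (cong (λ t → expPoly J t + expTerm J t) (ι*1/ m))
          (cong₂ _+_ (expPoly-1 J) (trans (cong (f *_) (1^k≡1 J)) (*-identityʳ f))))
        ([1+step]^≤expPoly j n ℕ.≤-refl)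
      base-eq : ∀ h → (1ℚ - h) * (1ℚ + h) ≡ 1ℚ - h * h
      base-eq = solve 1 (λ h → (con 1ℚ :- h) :* (con 1ℚ :+ h) := con 1ℚ :- h :* h) refl
      twice : ∀ h → 1ℚ - (1ℚ - h * h) ≡ h * h
      twice = solve 1 (λ h → con 1ℚ :- (con 1ℚ :- h :* h) := h :* h) refl
      0≤base : 0ℚ ≤ 1ℚ - h * h
      0≤base = subst (0ℚ ≤_) (base-eq h) (0≤* (0≤ratio m) (0≤+ (<⇒≤ 0<1) (0≤step m)))
      base≤1 : 1ℚ - h * h ≤ 1ℚ
      base≤1 = 0≤⇒≤ (subst (0ℚ ≤_) (sym (twice h)) (0≤* (0≤step m) (0≤step m)))
      product : 1ℚ - r ^ n * P ≤ h
      product = subst₂ _≤_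
        (cong (λ t → 1ℚ - t) (trans (cong (_^ n) (sym (base-eq h))) (^-distrib-* r (1ℚ + h) n)))
        (trans (cong (ι n *_) (twice h)) (trans (sym (*-assoc (ι n) h h)) (trans (cong (_* h) (ι*1/ m)) (*-identityˡ h))))
        (bernoulli 0≤base base≤1 n)
      slack : ∀ h R E f P → h + h - (1ℚ - R * E) ≡ (h - f) + (1ℚ - R) * f + R * (E + f - P) + (h - (1ℚ - R * P))
      slack = solve 5 (λ h R E f P → h :+ h :- (con 1ℚ :- R :* E)
        := (h :- f) :+ (con 1ℚ :- R) :* f :+ R :* (E :+ f :- P) :+ (h :- (con 1ℚ :- R :* P))) refl

  quot*ι : ∀ a {b} → 0 ℕ.< b → quot a b * ι b ≡ ι a
  quot*ι a {suc b} _ = quot-ι a b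

  *-cancelʳ : ∀ p q r → 0ℚ < r → p * r ≡ q * r → p ≡ q
  *-cancelʳ p q r 0<r eq = ≤-antisym
    (*-cancelʳ-≤-pos r {{positive 0<r}} (≤-reflexive eq))
    (*-cancelʳ-≤-pos r {{positive 0<r}} (≤-reflexive (sym eq)))

  0<ι⁺ : ∀ {n} → 0 ℕ.< n → 0ℚ < ι n
  0<ι⁺ {suc n} _ = 0<ι n

  ratio*ι : ∀ m → ratio m * ι (suc m) ≡ ι m
  ratio*ι m = begin
    (1ℚ - h) * ι (suc m)              ≡⟨ expand h (ι (suc m)) ⟩
    ι (suc m) - ι (suc m) * h         ≡⟨ cong₂ _-_ (ι-suc m) (ι*1/ m) ⟩
    1ℚ + ι m - 1ℚ                     ≡⟨ cancel (ι m) ⟩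
    ι m                               ∎
    where
    open ≡-Reasoning
    open +-*-Solver
    h = step m
    expand : ∀ h n → (1ℚ - h) * n ≡ n - n * h
    expand = solve 2 (λ h n → (con 1ℚ :- h) :* n := n :- n :* h) refl
    cancel : ∀ a → 1ℚ + a - 1ℚ ≡ a
    cancel = solve 1 (λ a → con 1ℚ :+ a :- con 1ℚ := a) refl

  -- The upper bounds `expSum j + invFactorial j` decrease from j = 1 on, where the value is 2 + 1.
  expSum≤3 : ∀ J → expSum J ≤ ι 3
  expSum≤3 zero    = ι-mono {1} {3} (ℕ.s≤s ℕ.z≤n)
  expSum≤3 (suc j) = subst (λ J → expSum J ≤ ι 3) (ℕ.+-comm j 1) (≤-trans
    (subst (_≤ expSum (j ℕ.+ 1) + invFactorial (j ℕ.+ 1)) (+-identityʳ (expSum (j ℕ.+ 1)))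
      (+-monoʳ-≤ (expSum (j ℕ.+ 1)) (0≤invFactorial (j ℕ.+ 1))))
    (expSum-upper 0 j))

  1≤expSum : ∀ J → 1ℚ ≤ expSum J
  1≤expSum J = subst (λ i → 1ℚ ≤ expSum i) (ℕ.+-identityʳ J) (expSum-mono 0 J)

  -- Explicit error bounds for the probability of safety

  safeProb : ℕ → ℕ → ℚ
  safeProb k m = quot ((m ℕ.^ k) C suc m) ((suc m ℕ.^ k) C suc m)

  module _ (k m : ℕ) (2≤k : 2 ℕ.≤ k) where

    private
      n = suc m
      M = m ℕ.^ k
      N = n ℕ.^ k
      h = step m
      r = ratio m
      ρ = r ^ k
      -- From 1 - ρ ≤ kh and N - i ≥ in, the shortfall i(1-ρ)/(N-i) is at most kh/n = kh². The n
      -- factors together then cost nκ = kh.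
      κ = ι k * h * h
      p = safeProb k m
      open +-*-Solver

    n≤N : n ℕ.≤ N
    n≤N = subst (ℕ._≤ N) (ℕ.^-identityʳ n) (ℕ.^-monoʳ-≤ n (ℕ.<⇒≤ 2≤k))

    0<NCn : 0 ℕ.< N C n
    0<NCn = C-positive n≤N

    private
      ρN≡M : ρ * ι N ≡ ι M
      ρN≡M = begin
        r ^ k * ι N           ≡⟨ cong (r ^ k *_) (ι-^ n k) ⟩
        r ^ k * ι n ^ k       ≡⟨ ^-distrib-* r (ι n) k ⟨
        (r * ι n) ^ k         ≡⟨ cong (_^ k) (ratio*ι m) ⟩
        ι m ^ k               ≡⟨ ι-^ m k ⟨
        ι M                   ∎
        where open ≡-Reasoning

      1-ρ≤kh : 1ℚ - ρ ≤ ι k * h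
      1-ρ≤kh = subst (λ t → 1ℚ - ρ ≤ ι k * t) (lem h) (bernoulli (0≤ratio m) (ratio≤1 m) k)
        where
        lem : ∀ h → 1ℚ - (1ℚ - h) ≡ h
        lem = solve 1 (λ h → con 1ℚ :- (con 1ℚ :- h) := h) refl

      0≤κ : 0ℚ ≤ κ
      0≤κ = 0≤* (0≤* (0≤ι k) (0≤step m)) (0≤step m)

      -- Dimension at least 2 is essential here: i ≤ m bounds the left side by mn + n = n², and N is
      -- at least n².
      in+i≤N : ∀ i → i ℕ.< n → i ℕ.* n ℕ.+ i ℕ.≤ N
      in+i≤N i (ℕ.s≤s i≤m) = begin
        i ℕ.* n ℕ.+ i            ≤⟨ ℕ.+-mono-≤ (ℕ.*-monoˡ-≤ n i≤m) (ℕ.m≤n⇒m≤1+n i≤m) ⟩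
        m ℕ.* n ℕ.+ n            ≡⟨ ℕ.+-comm (m ℕ.* n) n ⟩
        n ℕ.* n                  ≡⟨ cong (n ℕ.*_) (ℕ.*-identityʳ n) ⟨
        n ℕ.^ 2                  ≤⟨ ℕ.^-monoʳ-≤ n 2≤k ⟩
        N                        ∎
        where open ℕ.≤-Reasoning

      deficit : ∀ i → i ℕ.< n → ι i * (1ℚ - ρ) ≤ κ * (ι N - ι i)
      deficit i i<n = 0≤⇒≤ (subst (0ℚ ≤_) (sym slack)
        (0≤+ (0≤* 0≤κ (≤⇒0≤ (ι-mono (in+i≤N i i<n)))) (0≤* (0≤ι i) (≤⇒0≤ 1-ρ≤kh))))
        where
        open ≡-Reasoning
        a = ι i
        insert : ∀ k h N a ρ n → k * h * h * (N - a) - a * (1ℚ - ρ)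
          ≡ k * h * h * (N - (a * n + a)) + (a * (k * h * (n * h)) - a * (1ℚ - ρ))
        insert = solve 6 (λ k h N a ρ n → k :* h :* h :* (N :- a) :- a :* (con 1ℚ :- ρ)
          := k :* h :* h :* (N :- (a :* n :+ a)) :+ (a :* (k :* h :* (n :* h)) :- a :* (con 1ℚ :- ρ))) refl
        collect : ∀ a c ρ → a * (c * 1ℚ) - a * (1ℚ - ρ) ≡ a * (c - (1ℚ - ρ))
        collect = solve 3 (λ a c ρ → a :* (c :* con 1ℚ) :- a :* (con 1ℚ :- ρ) := a :* (c :- (con 1ℚ :- ρ))) refl
        slack : κ * (ι N - a) - a * (1ℚ - ρ) ≡ κ * (ι N - ι (i ℕ.* n ℕ.+ i)) + a * (ι k * h - (1ℚ - ρ))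
        slack = trans (insert (ι k) h (ι N) a ρ (ι n)) (cong₂ (λ s t → κ * (ι N - s) + t)
          (trans (cong (_+ a) (sym (ι-* i n))) (sym (ι-+ (i ℕ.* n) i)))
          (trans (cong (λ s → a * (ι k * h * s) - a * (1ℚ - ρ)) (ι*1/ m)) (collect a (ι k * h) ρ)))

      open BinomialRatio M N n n≤N ρ κ (0≤^ (0≤ratio m) k) (^≤1 (0≤ratio m) (ratio≤1 m) k) 0≤κ ρN≡M deficit

      B = ι (N C n)
      0<B : 0ℚ < B
      0<B = 0<ι⁺ 0<NCn

      gap≡ : ρ ^ n * B - ι (M C n) ≡ B * (ρ ^ n - p)
      gap≡ = trans (cong (λ t → ρ ^ n * B - t) (sym (quot*ι (M C n) 0<NCn))) (lem (ρ ^ n) B p)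
        where
        lem : ∀ R b p → R * b - p * b ≡ b * (R - p)
        lem = solve 3 (λ R b p → R :* b :- p :* b := b :* (R :- p)) refl

    safeProb≤ratio^ : 0ℚ ≤ ρ ^ n - p
    safeProb≤ratio^ = 0≤-cancel B _ 0<B (subst (0ℚ ≤_) gap≡ (0≤gap n ℕ.≤-refl))

    ratio^-safeProb≤ : ρ ^ n - p ≤ ι k * h
    ratio^-safeProb≤ = *-cancelˡ-≤-pos B {{positive 0<B}} (subst₂ _≤_ gap≡ nκB≡ (gap-upper n ℕ.≤-refl))
      where
      lem : ∀ n k h b → n * (k * h * h) * b ≡ b * (k * h * (n * h))
      lem = solve 4 (λ n k h b → n :* (k :* h :* h) :* b := b :* (k :* h :* (n :* h))) refl
      nκB≡ : ι n * κ * B ≡ B * (ι k * h)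
      nκB≡ = trans (lem (ι n) (ι k) h B)
        (cong (B *_) (trans (cong (ι k * h *_) (ι*1/ m)) (*-identityʳ (ι k * h))))

    module _ (J : ℕ) (2+m≤J : 2 ℕ.+ m ℕ.≤ J) where

      private
        E = expSum J ^ k
        u = r ^ n * expSum J
        0≤expSum = ≤-trans (<⇒≤ 0<1) (1≤expSum J)
        0≤E : 0ℚ ≤ E
        0≤E = 0≤^ 0≤expSum k
        0≤u : 0ℚ ≤ u
        0≤u = 0≤* (0≤^ (0≤ratio m) n) 0≤expSum
        u≤1 : u ≤ 1ℚ
        u≤1 = ratio^*expSum≤1 m J

        u^k≡ : u ^ k ≡ ρ ^ n * E
        u^k≡ = begin
          (r ^ n * expSum J) ^ k       ≡⟨ ^-distrib-* (r ^ n) (expSum J) k ⟩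
          (r ^ n) ^ k * E              ≡⟨ cong (_* E) (^-assocʳ r n k) ⟩
          r ^ (n ℕ.* k) * E            ≡⟨ cong (λ l → r ^ l * E) (ℕ.*-comm n k) ⟩
          r ^ (k ℕ.* n) * E            ≡⟨ cong (_* E) (^-assocʳ r k n) ⟨
          ρ ^ n * E                    ∎
          where open ≡-Reasoning

        -- Inserting `ρ ^ n * E`, which is `u ^ k`, separates the error of approximating 1/e by r^n
        -- from the error of replacing draws without replacement by independent ones.
        1-pE≡ : 1ℚ - p * E ≡ (1ℚ - u ^ k) + E * (ρ ^ n - p)
        1-pE≡ = trans (lem p E (ρ ^ n)) (cong (λ t → (1ℚ - t) + E * (ρ ^ n - p)) (sym u^k≡))
          where
          lem : ∀ p E R → 1ℚ - p * E ≡ (1ℚ - R * E) + E * (R - p)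
          lem = solve 3 (λ p E R → con 1ℚ :- p :* E := (con 1ℚ :- R :* E) :+ E :* (R :- p)) refl

      0≤1-safeProb*e^k : 0ℚ ≤ 1ℚ - p * E
      0≤1-safeProb*e^k = subst (0ℚ ≤_) (sym 1-pE≡)
        (0≤+ (≤⇒0≤ (^≤1 0≤u u≤1 k)) (0≤* 0≤E safeProb≤ratio^))

      -- Origin of the constant: Bernoulli turns 1 - u ≤ 2h into 2kh for `u ^ k`, and the sampling
      -- error kh is multiplied by E ≤ 3^k.
      1-safeProb*e^k≤ : 1ℚ - p * E ≤ ι k * (1ℚ + 1ℚ + ι 3 ^ k) * h
      1-safeProb*e^k≤ = subst₂ _≤_ (sym 1-pE≡) (lem (ι k) h (ι 3 ^ k))
        (+-mono-≤ {1ℚ - u ^ k}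
          (≤-trans (bernoulli 0≤u u≤1 k)
            (*-monoˡ-≤-nonNeg (ι k) {{nonNegative (0≤ι k)}} (1-ratio^*expSum≤ m J 2+m≤J)))
          (*-mono-≤ E (ι 3 ^ k) (ρ ^ n - p) (ι k * h) (0≤^ (0≤ι 3) k) safeProb≤ratio^
            (^-mono-≤ 0≤expSum (expSum≤3 J) k) ratio^-safeProb≤))
        where
        lem : ∀ k h T → k * (h + h) + T * (k * h) ≡ k * (1ℚ + 1ℚ + T) * h
        lem = solve 3 (λ k h T → k :* (h :+ h) :+ T :* (k :* h) := k :* (con 1ℚ :+ con 1ℚ :+ T) :* h) refl

  -- Passage to real limits

  seq-e^ : ∀ k J → seq (e ^ℝ k) J ≡ expSum J ^ k
  seq-e^ zero    J = refl
  seq-e^ (suc k) J = cong (expSum J *_) (seq-e^ k J)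

  1≤^ : ∀ {x} → 1ℚ ≤ x → ∀ k → 1ℚ ≤ x ^ k
  1≤^ {x} 1≤x k = subst (_≤ x ^ k) (1^k≡1 k) (^-mono-≤ (<⇒≤ 0<1) 1≤x k)

  recip≤1 : ∀ {x} → 1ℚ ≤ x → recip x ≤ 1ℚ
  recip≤1 {x} 1≤x = subst₂ _≤_ (*-identityˡ (recip x)) (p*recip[p]≡1 0<x)
    (*-monoʳ-≤-nonNeg (recip x) {{nonNegative (<⇒≤ (0<recip 0<x))}} 1≤x)
    where 0<x = <-≤-trans 0<1 1≤x

  -- The strict inequality of reals requires a margin bounded away from 0. Half of ε bounds the
  -- distance and the other half is the margin; the entries with J < m + 2 are skipped by starting
  -- the tail at `2 ℕ.+ m`.
  ⟶-intro : ∀ (a : ℕ → ℝ) L c → 0ℚ < c →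
    (∀ m J → 2 ℕ.+ m ℕ.≤ J → ∣ seq (a m) J - seq L J ∣ ≤ c * step m) → a ⟶ L
  ⟶-intro a L c 0<c close ε 0<ε = K , λ m K≤m → δ , 0<δ , 2 ℕ.+ m , λ J 2+m≤J → half-left (begin
    ∣ seq (a m) J - seq L J ∣   ≤⟨ close m J 2+m≤J ⟩
    c * step m                  ≤⟨ *-monoˡ-≤-nonNeg c {{nonNegative (<⇒≤ 0<c)}} (1/suc-anti K≤m) ⟩
    c * step K                  ≤⟨ *-monoˡ-≤-nonNeg c {{nonNegative (<⇒≤ 0<c)}} step≤ ⟩
    c * (1/⁺ 0<c * δ)           ≡⟨ *-assoc c (1/⁺ 0<c) δ ⟨
    c * 1/⁺ 0<c * δ             ≡⟨ cong (_* δ) (p*1/⁺p≡1 0<c) ⟩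
    1ℚ * δ                      ≡⟨ *-identityˡ δ ⟩
    δ                           ∎)
    where
    open ≤-Reasoning
    δ = ½ * ε
    0<δ = 0<p*q ½ ε 0<½ 0<ε
    arch = archimedean (1/⁺ 0<c * δ) (0<p*q (1/⁺ 0<c) δ (0<1/⁺ 0<c) 0<δ)
    K = proj₁ arch
    step≤ = proj₂ arch
    half-left : ∀ {x} → x ≤ δ → δ ≤ ε - x
    half-left {x} x≤δ = 0≤⇒≤ (subst (0ℚ ≤_) (trans (lem δ x) (cong (λ t → t - x - δ) (½p+½p≡p ε))) (≤⇒0≤ x≤δ))
      where
      open +-*-Solver
      lem : ∀ δ x → δ - x ≡ δ + δ - x - δ
      lem = solve 2 (λ δ x → δ :- x := δ :+ δ :- x :- δ) refl

  module _ (k : ℕ) (1≤k : 1 ℕ.≤ k) where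

    private
      2≤k = ℕ.s≤s 1≤k
      c = ι (suc k) * (1ℚ + 1ℚ + ι 3 ^ suc k)
      0<c : 0ℚ < c
      0<c = 0<p*q (ι (suc k)) (1ℚ + 1ℚ + ι 3 ^ suc k) (0<ι k)
        (subst (0ℚ <_) (+-comm (ι 3 ^ suc k) (1ℚ + 1ℚ)) (0<p+q (0≤^ (0≤ι 3) (suc k)) (0<p+q (<⇒≤ 0<1) 0<1)))

      expS : ℕ → ℚ
      expS J = seq (e ^ℝ suc k) J

      1≤expS : ∀ J → 1ℚ ≤ expS J
      1≤expS J = subst (1ℚ ≤_) (sym (seq-e^ (suc k) J)) (1≤^ (1≤expSum J) (suc k))

      0<expS : ∀ J → 0ℚ < expS J
      0<expS J = <-≤-trans 0<1 (1≤expS J)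

      P : ℕ → ℚ
      P = safeProb (suc k)

      module _ (m J : ℕ) (2+m≤J : 2 ℕ.+ m ℕ.≤ J) where

        0≤1-pE : 0ℚ ≤ 1ℚ - P m * expS J
        0≤1-pE = subst (λ t → 0ℚ ≤ 1ℚ - P m * t) (sym (seq-e^ (suc k) J)) (0≤1-safeProb*e^k (suc k) m 2≤k J 2+m≤J)

        1-pE≤ : 1ℚ - P m * expS J ≤ c * step m
        1-pE≤ = subst (λ t → 1ℚ - P m * t ≤ c * step m) (sym (seq-e^ (suc k) J)) (1-safeProb*e^k≤ (suc k) m 2≤k J 2+m≤J)

        ∣pE-1∣≤ : ∣ P m * expS J - 1ℚ ∣ ≤ c * step m
        ∣pE-1∣≤ = subst (_≤ c * step m)
          (trans (sym (0≤p⇒∣p∣≡p 0≤1-pE)) (∣p-q∣≡∣q-p∣ 1ℚ (P m * expS J))) 1-pE≤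

        -- p - 1/E is 1/E times pE - 1, and 1/E ≤ 1, so the constant of the first limit serves
        -- again.
        ∣p-1/E∣≤ : ∣ P m - 1ℚ * recip (expS J) ∣ ≤ c * step m
        ∣p-1/E∣≤ = begin
          ∣ p - 1ℚ * R ∣                ≡⟨ cong ∣_∣ p-1/E≡ ⟩
          ∣ R * (p * X - 1ℚ) ∣          ≡⟨ ∣p*q∣≡∣p∣*∣q∣ R (p * X - 1ℚ) ⟩
          ∣ R ∣ * ∣ p * X - 1ℚ ∣        ≡⟨ cong (_* ∣ p * X - 1ℚ ∣) (0≤p⇒∣p∣≡p (<⇒≤ (0<recip (0<expS J)))) ⟩
          R * ∣ p * X - 1ℚ ∣            ≤⟨ *-monoʳ-≤-nonNeg (∣ p * X - 1ℚ ∣) {{nonNegative (0≤∣p∣ (p * X - 1ℚ))}} (recip≤1 (1≤expS J)) ⟩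
          1ℚ * ∣ p * X - 1ℚ ∣           ≡⟨ *-identityˡ (∣ p * X - 1ℚ ∣) ⟩
          ∣ p * X - 1ℚ ∣                ≤⟨ ∣pE-1∣≤ ⟩
          c * step m                    ∎
          where
          open ≤-Reasoning
          open +-*-Solver
          X = expS J
          R = recip X
          p = P m
          lem₁ : ∀ p R → p - 1ℚ * R ≡ p * 1ℚ - R
          lem₁ = solve 2 (λ p R → p :- con 1ℚ :* R := p :* con 1ℚ :- R) refl
          lem₂ : ∀ p X R → p * (X * R) - R ≡ R * (p * X - 1ℚ)
          lem₂ = solve 3 (λ p X R → p :* (X :* R) :- R := R :* (p :* X :- con 1ℚ)) refl
          p-1/E≡ : p - 1ℚ * R ≡ R * (p * X - 1ℚ)
          p-1/E≡ = trans (lem₁ p R) (trans (cong (λ t → p * t - R) (sym (p*recip[p]≡1 (0<expS J)))) (lem₂ p X R))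

      probSafe≡ : ∀ m x → Board.probSafe (suc k) (suc m) x ≡ safeProb (suc k) m
      probSafe≡ m x = cong₂ quot (count-safe k m x) (length-configurations k m)

      expectedSafe≡ : ∀ m → Board.expectedSafe (suc k) (suc m) ≡ ι (suc m ℕ.^ suc k) * safeProb (suc k) m
      expectedSafe≡ m = *-cancelʳ _ _ B (0<ι⁺ 0<b) (begin
        Board.expectedSafe (suc k) (suc m) * B   ≡⟨ cong (_* B) (cong₂ quot (total-safe k m) (length-configurations k m)) ⟩
        quot (N ℕ.* a) b * B                     ≡⟨ quot*ι (N ℕ.* a) 0<b ⟩
        ι (N ℕ.* a)                              ≡⟨ ι-* N a ⟩
        ι N * ι a                                ≡⟨ cong (ι N *_) (quot*ι a 0<b) ⟨
        ι N * (quot a b * B)                     ≡⟨ *-assoc (ι N) (quot a b) B ⟨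
        ι N * quot a b * B                       ∎)
        where
        open ≡-Reasoning
        N = suc m ℕ.^ suc k
        a = (m ℕ.^ suc k) C suc m
        b = N C suc m
        B = ι b
        0<b = 0<NCn (suc k) m 2≤k

      boardSize/e^k : ℕ → ℝ
      boardSize/e^k m = fromℕ (suc m ℕ.^ suc k) ÷ℝ (e ^ℝ suc k) [ e^-positive (suc k) ]

      0<boardSize : ∀ m → 0ℚ < ι (suc m ℕ.^ suc k)
      0<boardSize m = 0<ι⁺ (ℕ.m^n>0 (suc m) (suc k))

      boardSize/e^k-positive : ∀ m → Positiveℝ (boardSize/e^k m)
      boardSize/e^k-positive m = *-positive (fromℕ (suc m ℕ.^ suc k)) (reciprocal (e ^ℝ suc k) (e^-positive (suc k)))
        (ι (suc m ℕ.^ suc k) , 0<boardSize m , 0 , λ _ _ → ≤-refl)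
        -- The partial sums stay below 3, which keeps the reciprocals of the entries of e^k away
        -- from 0.
        (recip (ι 3 ^ suc k) , 0<recip 0<3^k , 0 , λ J _ → recip-anti (0<expS J)
          (subst (_≤ ι 3 ^ suc k) (sym (seq-e^ (suc k) J))
            (^-mono-≤ (≤-trans (<⇒≤ 0<1) (1≤expSum J)) (expSum≤3 J) (suc k))))
        where
        0<3^k : 0ℚ < ι 3 ^ suc k
        0<3^k = <-≤-trans 0<1 (1≤^ (ι-mono {1} {3} (ℕ.s≤s ℕ.z≤n)) (suc k))

      -- The board size cancels entry by entry, so the quotient in the asymptotic statement is
      -- exactly p times the J-th entry of e^k, the quantity already estimated.
      expectedSafe÷≡ : ∀ m J → Board.expectedSafe (suc k) (suc m) * recip (seq (boardSize/e^k m) J)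
        ≡ safeProb (suc k) m * expS J
      expectedSafe÷≡ m J = begin
        Board.expectedSafe (suc k) (suc m) * recip y   ≡⟨ cong (_* recip y) (expectedSafe≡ m) ⟩
        S * p * recip y                                ≡⟨ lem₁ S p (recip y) ⟩
        -- Writing 1 as `X * R` supplies the factor `R` that completes `S` to `y`, so `recip y`
        -- cancels without a rule for the reciprocal of a product.
        p * 1ℚ * (S * recip y)                         ≡⟨ cong (λ t → p * t * (S * recip y)) (p*recip[p]≡1 (0<expS J)) ⟨
        p * (X * R) * (S * recip y)                    ≡⟨ lem₂ p X R S (recip y) ⟩
        p * X * (S * R * recip y)                      ≡⟨ cong (p * X *_) (p*recip[p]≡1 0<y) ⟩
        p * X * 1ℚ                                     ≡⟨ *-identityʳ (p * X) ⟩
        p * X                                          ∎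
        where
        open ≡-Reasoning
        open +-*-Solver
        S = ι (suc m ℕ.^ suc k)
        X = expS J
        R = recip X
        y = S * R
        p = safeProb (suc k) m
        0<y : 0ℚ < y
        0<y = 0<p*q S R (0<boardSize m) (0<recip (0<expS J))
        lem₁ : ∀ S p r → S * p * r ≡ p * 1ℚ * (S * r)
        lem₁ = solve 3 (λ S p r → S :* p :* r := p :* con 1ℚ :* (S :* r)) refl
        lem₂ : ∀ p X R S r → p * (X * R) * (S * r) ≡ p * X * (S * R * r)
        lem₂ = solve 5 (λ p X R S r → p :* (X :* R) :* (S :* r) := p :* X :* (S :* R :* r)) refl

    expectedSafe-asymptotic : (λ m → fromℚ (Board.expectedSafe (suc k) (suc m)))
      ∼ (λ m → fromℕ (suc m ℕ.^ suc k) ÷ℝ (e ^ℝ suc k) [ e^-positive (suc k) ])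
    expectedSafe-asymptotic = boardSize/e^k-positive , ⟶-intro
      (λ m → fromℚ (Board.expectedSafe (suc k) (suc m)) ÷ℝ boardSize/e^k m [ boardSize/e^k-positive m ]) (fromℕ 1) c 0<c λ m J 2+m≤J →
      subst (λ t → ∣ t - 1ℚ ∣ ≤ c * step m) (sym (expectedSafe÷≡ m J)) (∣pE-1∣≤ m J 2+m≤J)

    probSafe-limit : (x : (m : ℕ) → Board.Space (suc k) (suc m)) →
      (λ m → fromℚ (Board.probSafe (suc k) (suc m) (x m)))
        ⟶ (fromℕ 1 ÷ℝ (e ^ℝ suc k) [ e^-positive (suc k) ])
    probSafe-limit x = ⟶-intro
      (λ m → fromℚ (Board.probSafe (suc k) (suc m) (x m))) (fromℕ 1 ÷ℝ (e ^ℝ suc k) [ e^-positive (suc k) ]) c 0<c λ m J 2+m≤J →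
      subst (λ t → ∣ t - 1ℚ * recip (expS J) ∣ ≤ c * step m) (sym (probSafe≡ m (x m))) (∣p-1/E∣≤ m J 2+m≤J)

open Asymptotics using (expectedSafe-asymptotic; probSafe-limit)
open import Data.Nat.Base using (ℕ; suc; s≤s; _≤_; _^_)
open import Data.Product.Base using (_×_; _,_)

theorem1p6 : (k : ℕ) → 2 ≤ k →
    ((λ m → fromℚ (Board.expectedSafe k (suc m)))
    ∼ (λ m → fromℕ (suc m ^ k) ÷ℝ (e ^ℝ k) [ e^-positive k ]))
    × ((x : (m : ℕ) → Board.Space k (suc m)) →
    (λ m → fromℚ (Board.probSafe k (suc m) (x m)))
    ⟶ (fromℕ 1 ÷ℝ (e ^ℝ k) [ e^-positive k ]))
theorem1p6 (suc k) (s≤s 1≤k) = expectedSafe-asymptotic k 1≤k , probSafe-limit k 1≤k
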